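{- Let $\mathbb{K}$ be a field and $f=a_0(x)+a_1(x)y+\cdots+a_n(x)y^n\in\mathbb{K}[x,y]$ with $n\geq 2$, $a_0,\ldots,a_n\in\mathbb{K}[x]$, $a_0a_n\neq 0$. Assume that $f$ has no nonconstant factor in $\mathbb{K}[x]$, and let $\nu_0$ and $\nu_n$ be the number of irreducible factors of $a_0(x)$ and $a_n(x)$ in $\mathbb{K}[x]$, respectively, counted with their multiplicities. Then $f$ is a product of at most $\nu=\min\{\nu_0,\nu_n\}$ irreducible polynomials over $\mathbb{K}[x]$ in each of the following two cases: (i) $a_0$ is reducible over $\mathbb{K}$, $\deg a_n\geq\deg a_0-\deg q$ where $q\in\mathbb{K}[x]$ is an irreducible factor of $a_0$ of smallest degree, and $\deg a_0>\max\{\deg a_1,\dots,\deg a_n\}$; (ii) $a_n$ is reducible over $\mathbb{K}$, $\deg a_0\geq\deg a_n-\deg q$ where $q\in\mathbb{K}[x]$ is an irreducible factor of $a_n$ of smallest degree, and $\deg a_n>\max\{\deg a_0,\dots,\deg a_{n-1}\}$.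
   Context: $f$ is regarded as a polynomial in $y$ with coefficients in $\mathbb{K}[x]$; "a product of at most $k$ irreducible polynomials over $\mathbb{K}[x]$" means that in the factorization of $f$ into irreducible elements of $\mathbb{K}[x][y]$ the number of factors, counted with multiplicities, is at most $k$. -}

module Defs where

open import Algebra.Bundles using (CommutativeRing; Semiring)
open import Algebra.Structures using (IsCommutativeRing)
import Algebra.Definitions.RawSemiring as RawSemiringDefs
open import Data.Fin.Base using (Fin)
open import Data.List.Base using (List; []; _∷_; map)
open import Data.Nat.Base as ℕ using (ℕ; zero; suc)
open import Data.Product.Base using (_×_; _,_; ∃; ∃₂)
open import Data.Vec.Functional using (Vector)
open import Level using (Level; _⊔_) renaming (suc to lsuc)
open import Relation.Binary.Bundles using (Setoid)
open import Relation.Binary.Structures using (IsEquivalence)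
import Relation.Binary.Reasoning.Setoid as SetoidReasoning
open import Relation.Nullary.Negation.Core using (¬_)

private
  variable
    c ℓ : Level

record Field c ℓ : Set (lsuc (c ⊔ ℓ)) where
  field
    commutativeRing : CommutativeRing c ℓ
  open CommutativeRing commutativeRing public
  field
    1≉0     : ¬ (1# ≈ 0#)
    inverse : ∀ x → ¬ (x ≈ 0#) → ∃ λ y → x * y ≈ 1#

-- A polynomial is a list of coefficients, constant coefficient first.
-- Trailing zeros are allowed: equality compares coefficients.

module Polynomials (R : CommutativeRing c ℓ) where

  open CommutativeRing R
    renaming ( Carrier to A; _+_ to _⊕_; _*_ to _⊗_; -_ to ⊖_
             ; refl to reflᴬ; sym to symᴬ; trans to transᴬ )
    using ( _≈_; 0#; 1#; setoid; +-cong; +-congˡ; +-congʳ; +-assoc; +-comm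
          ; +-identityˡ; +-identityʳ; -‿cong; -‿inverseʳ; *-cong; *-congˡ
          ; *-congʳ; *-assoc; *-comm; *-identityˡ; zeroˡ; zeroʳ; distribˡ
          ; distribʳ; +-commutativeSemigroup; ring)
  open import Algebra.Properties.CommutativeSemigroup +-commutativeSemigroup
    using (interchange)
  open import Algebra.Properties.Ring ring using (-0#≈0#)

  Polynomial : Set c
  Polynomial = List A

  coeff : Polynomial → ℕ → A
  coeff []      _       = 0#
  coeff (a ∷ p) zero    = a
  coeff (a ∷ p) (suc i) = coeff p i

  infix 4 _≈ₚ_
  record _≈ₚ_ (p q : Polynomial) : Set ℓ where
    constructor coeffwise
    field coeff-≈ : ∀ i → coeff p i ≈ coeff q i
  open _≈ₚ_ public

  const : A → Polynomial
  const a = a ∷ []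

  infixl 6 _+ₚ_
  infixl 7 _*ₚ_ _·_

  _+ₚ_ : Polynomial → Polynomial → Polynomial
  []      +ₚ q       = q
  (a ∷ p) +ₚ []      = a ∷ p
  (a ∷ p) +ₚ (b ∷ q) = (a ⊕ b) ∷ (p +ₚ q)

  -ₚ_ : Polynomial → Polynomial
  -ₚ_ = map ⊖_

  _·_ : A → Polynomial → Polynomial
  a · p = map (a ⊗_) p

  _*ₚ_ : Polynomial → Polynomial → Polynomial
  []      *ₚ q = []
  (a ∷ p) *ₚ q = a · q +ₚ (0# ∷ p *ₚ q)

  HasDegree : Polynomial → ℕ → Set ℓ
  HasDegree p d = ¬ (coeff p d ≈ 0#) × (∀ i → d ℕ.< i → coeff p i ≈ 0#)

  -- The zero polynomial has no degree, so 0 deg< q holds for every q ≠ 0.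
  infix 4 _deg<_
  _deg<_ : Polynomial → Polynomial → Set ℓ
  p deg< q = ∃ λ d → HasDegree q d × (∀ e → HasDegree p e → e ℕ.< d)

  Constant : Polynomial → Set (c ⊔ ℓ)
  Constant p = ∃ λ a → p ≈ₚ const a

  coeff-+ : ∀ p q i → coeff (p +ₚ q) i ≈ coeff p i ⊕ coeff q i
  coeff-+ []      q       i       = symᴬ (+-identityˡ _)
  coeff-+ (a ∷ p) []      i       = symᴬ (+-identityʳ _)
  coeff-+ (a ∷ p) (b ∷ q) zero    = reflᴬ
  coeff-+ (a ∷ p) (b ∷ q) (suc i) = coeff-+ p q i

  coeff-neg : ∀ p i → coeff (-ₚ p) i ≈ ⊖ coeff p i
  coeff-neg []      i       = symᴬ -0#≈0#
  coeff-neg (a ∷ p) zero    = reflᴬ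
  coeff-neg (a ∷ p) (suc i) = coeff-neg p i

  coeff-· : ∀ a p i → coeff (a · p) i ≈ a ⊗ coeff p i
  coeff-· a []      i       = symᴬ (zeroʳ a)
  coeff-· a (b ∷ p) zero    = reflᴬ
  coeff-· a (b ∷ p) (suc i) = coeff-· a p i

  ≈ₚ-refl : ∀ {p} → p ≈ₚ p
  ≈ₚ-refl .coeff-≈ i = reflᴬ

  ≈ₚ-sym : ∀ {p q} → p ≈ₚ q → q ≈ₚ p
  ≈ₚ-sym e .coeff-≈ i = symᴬ (coeff-≈ e i)

  ≈ₚ-trans : ∀ {p q r} → p ≈ₚ q → q ≈ₚ r → p ≈ₚ r
  ≈ₚ-trans e f .coeff-≈ i = transᴬ (coeff-≈ e i) (coeff-≈ f i)

  ≈ₚ-isEquivalence : IsEquivalence _≈ₚ_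
  ≈ₚ-isEquivalence = record { refl = ≈ₚ-refl ; sym = ≈ₚ-sym ; trans = ≈ₚ-trans }

  ≈ₚ-setoid : Setoid c ℓ
  ≈ₚ-setoid = record { isEquivalence = ≈ₚ-isEquivalence }

  private
    module ≈-Reasoning = SetoidReasoning setoid
    module ≈ₚ-Reasoning = SetoidReasoning ≈ₚ-setoid

  ∷-cong : ∀ {a b p q} → a ≈ b → p ≈ₚ q → a ∷ p ≈ₚ b ∷ q
  ∷-cong e f .coeff-≈ zero    = e
  ∷-cong e f .coeff-≈ (suc i) = coeff-≈ f i

  0∷[]≈[] : 0# ∷ [] ≈ₚ []
  0∷[]≈[] .coeff-≈ zero    = reflᴬ
  0∷[]≈[] .coeff-≈ (suc i) = reflᴬ

  +ₚ-cong : ∀ {p p′ q q′} → p ≈ₚ p′ → q ≈ₚ q′ → p +ₚ q ≈ₚ p′ +ₚ q′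
  +ₚ-cong {p} {p′} {q} {q′} e f .coeff-≈ i = begin
    coeff (p +ₚ q) i          ≈⟨ coeff-+ p q i ⟩
    coeff p i ⊕ coeff q i     ≈⟨ +-cong (coeff-≈ e i) (coeff-≈ f i) ⟩
    coeff p′ i ⊕ coeff q′ i   ≈⟨ coeff-+ p′ q′ i ⟨
    coeff (p′ +ₚ q′) i        ∎
    where open ≈-Reasoning

  -ₚ-cong : ∀ {p q} → p ≈ₚ q → -ₚ p ≈ₚ -ₚ q
  -ₚ-cong {p} {q} e .coeff-≈ i =
    transᴬ (coeff-neg p i) (transᴬ (-‿cong (coeff-≈ e i)) (symᴬ (coeff-neg q i)))

  +ₚ-comm : ∀ p q → p +ₚ q ≈ₚ q +ₚ p
  +ₚ-comm p q .coeff-≈ i =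
    transᴬ (coeff-+ p q i) (transᴬ (+-comm _ _) (symᴬ (coeff-+ q p i)))

  +ₚ-assoc : ∀ p q r → (p +ₚ q) +ₚ r ≈ₚ p +ₚ (q +ₚ r)
  +ₚ-assoc p q r .coeff-≈ i = begin
    coeff ((p +ₚ q) +ₚ r) i                  ≈⟨ coeff-+ (p +ₚ q) r i ⟩
    coeff (p +ₚ q) i ⊕ coeff r i             ≈⟨ +-congʳ (coeff-+ p q i) ⟩
    (coeff p i ⊕ coeff q i) ⊕ coeff r i      ≈⟨ +-assoc _ _ _ ⟩
    coeff p i ⊕ (coeff q i ⊕ coeff r i)      ≈⟨ +-congˡ (coeff-+ q r i) ⟨
    coeff p i ⊕ coeff (q +ₚ r) i             ≈⟨ coeff-+ p (q +ₚ r) i ⟨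
    coeff (p +ₚ (q +ₚ r)) i                  ∎
    where open ≈-Reasoning

  +ₚ-identityʳ : ∀ p → p +ₚ [] ≈ₚ p
  +ₚ-identityʳ p = +ₚ-comm p []

  -ₚ-inverseʳ : ∀ p → p +ₚ (-ₚ p) ≈ₚ []
  -ₚ-inverseʳ p .coeff-≈ i = begin
    coeff (p +ₚ (-ₚ p)) i           ≈⟨ coeff-+ p (-ₚ p) i ⟩
    coeff p i ⊕ coeff (-ₚ p) i      ≈⟨ +-congˡ (coeff-neg p i) ⟩
    coeff p i ⊕ (⊖ coeff p i)       ≈⟨ -‿inverseʳ _ ⟩
    0#                              ∎
    where open ≈-Reasoning

  -ₚ-inverseˡ : ∀ p → (-ₚ p) +ₚ p ≈ₚ []
  -ₚ-inverseˡ p = ≈ₚ-trans (+ₚ-comm (-ₚ p) p) (-ₚ-inverseʳ p)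

  ·-cong : ∀ {a b p q} → a ≈ b → p ≈ₚ q → a · p ≈ₚ b · q
  ·-cong {a} {b} {p} {q} e f .coeff-≈ i =
    transᴬ (coeff-· a p i) (transᴬ (*-cong e (coeff-≈ f i)) (symᴬ (coeff-· b q i)))

  ·-zeroˡ : ∀ p → 0# · p ≈ₚ []
  ·-zeroˡ p .coeff-≈ i = transᴬ (coeff-· 0# p i) (zeroˡ _)

  ·-identityˡ : ∀ p → 1# · p ≈ₚ p
  ·-identityˡ p .coeff-≈ i = transᴬ (coeff-· 1# p i) (*-identityˡ _)

  ·-distribʳ : ∀ p a b → (a ⊕ b) · p ≈ₚ a · p +ₚ b · p
  ·-distribʳ p a b .coeff-≈ i = begin
    coeff ((a ⊕ b) · p) i                ≈⟨ coeff-· (a ⊕ b) p i ⟩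
    (a ⊕ b) ⊗ coeff p i                  ≈⟨ distribʳ _ _ _ ⟩
    a ⊗ coeff p i ⊕ b ⊗ coeff p i        ≈⟨ +-cong (coeff-· a p i) (coeff-· b p i) ⟨
    coeff (a · p) i ⊕ coeff (b · p) i    ≈⟨ coeff-+ (a · p) (b · p) i ⟨
    coeff (a · p +ₚ b · p) i             ∎
    where open ≈-Reasoning

  ·-distribˡ : ∀ a p q → a · (p +ₚ q) ≈ₚ a · p +ₚ a · q
  ·-distribˡ a p q .coeff-≈ i = begin
    coeff (a · (p +ₚ q)) i               ≈⟨ coeff-· a (p +ₚ q) i ⟩
    a ⊗ coeff (p +ₚ q) i                 ≈⟨ *-congˡ (coeff-+ p q i) ⟩
    a ⊗ (coeff p i ⊕ coeff q i)          ≈⟨ distribˡ _ _ _ ⟩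
    a ⊗ coeff p i ⊕ a ⊗ coeff q i        ≈⟨ +-cong (coeff-· a p i) (coeff-· a q i) ⟨
    coeff (a · p) i ⊕ coeff (a · q) i    ≈⟨ coeff-+ (a · p) (a · q) i ⟨
    coeff (a · p +ₚ a · q) i             ∎
    where open ≈-Reasoning

  ·-assoc : ∀ a b p → a · (b · p) ≈ₚ (a ⊗ b) · p
  ·-assoc a b p .coeff-≈ i = begin
    coeff (a · (b · p)) i    ≈⟨ coeff-· a (b · p) i ⟩
    a ⊗ coeff (b · p) i      ≈⟨ *-congˡ (coeff-· b p i) ⟩
    a ⊗ (b ⊗ coeff p i)      ≈⟨ *-assoc _ _ _ ⟨
    (a ⊗ b) ⊗ coeff p i      ≈⟨ coeff-· (a ⊗ b) p i ⟨
    coeff ((a ⊗ b) · p) i    ∎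
    where open ≈-Reasoning

  +ₚ-interchange : ∀ p q r s → (p +ₚ q) +ₚ (r +ₚ s) ≈ₚ (p +ₚ r) +ₚ (q +ₚ s)
  +ₚ-interchange p q r s .coeff-≈ i = begin
    coeff ((p +ₚ q) +ₚ (r +ₚ s)) i                            ≈⟨ expand p q r s ⟩
    (coeff p i ⊕ coeff q i) ⊕ (coeff r i ⊕ coeff s i)         ≈⟨ interchange _ _ _ _ ⟩
    (coeff p i ⊕ coeff r i) ⊕ (coeff q i ⊕ coeff s i)         ≈⟨ expand p r q s ⟨
    coeff ((p +ₚ r) +ₚ (q +ₚ s)) i                            ∎
    where
    open ≈-Reasoning
    expand : ∀ p q r s → coeff ((p +ₚ q) +ₚ (r +ₚ s)) i
                       ≈ (coeff p i ⊕ coeff q i) ⊕ (coeff r i ⊕ coeff s i)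
    expand p q r s = transᴬ (coeff-+ (p +ₚ q) (r +ₚ s) i)
                            (+-cong (coeff-+ p q i) (coeff-+ r s i))

  *ₚ-zeroʳ : ∀ p → p *ₚ [] ≈ₚ []
  *ₚ-zeroʳ []      = ≈ₚ-refl
  *ₚ-zeroʳ (a ∷ p) = ≈ₚ-trans (∷-cong reflᴬ (*ₚ-zeroʳ p)) 0∷[]≈[]

  *ₚ-congˡ : ∀ p {q q′} → q ≈ₚ q′ → p *ₚ q ≈ₚ p *ₚ q′
  *ₚ-congˡ []      e = ≈ₚ-refl
  *ₚ-congˡ (a ∷ p) e = +ₚ-cong (·-cong reflᴬ e) (∷-cong reflᴬ (*ₚ-congˡ p e))

  *ₚ-∷ʳ : ∀ p b q → p *ₚ (b ∷ q) ≈ₚ b · p +ₚ (0# ∷ p *ₚ q)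
  *ₚ-∷ʳ []      b q = ≈ₚ-sym 0∷[]≈[]
  *ₚ-∷ʳ (a ∷ p) b q = ∷-cong (+-congʳ (*-comm a b)) (begin
    a · q +ₚ (p *ₚ (b ∷ q))               ≈⟨ +ₚ-cong ≈ₚ-refl (*ₚ-∷ʳ p b q) ⟩
    a · q +ₚ (b · p +ₚ (0# ∷ p *ₚ q))     ≈⟨ +ₚ-assoc (a · q) (b · p) _ ⟨
    (a · q +ₚ b · p) +ₚ (0# ∷ p *ₚ q)     ≈⟨ +ₚ-cong (+ₚ-comm (a · q) (b · p)) ≈ₚ-refl ⟩
    (b · p +ₚ a · q) +ₚ (0# ∷ p *ₚ q)     ≈⟨ +ₚ-assoc (b · p) (a · q) _ ⟩
    b · p +ₚ (a · q +ₚ (0# ∷ p *ₚ q))     ∎)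
    where open ≈ₚ-Reasoning

  *ₚ-comm : ∀ p q → p *ₚ q ≈ₚ q *ₚ p
  *ₚ-comm []      q = ≈ₚ-sym (*ₚ-zeroʳ q)
  *ₚ-comm (a ∷ p) q = ≈ₚ-trans
    (+ₚ-cong ≈ₚ-refl (∷-cong reflᴬ (*ₚ-comm p q))) (≈ₚ-sym (*ₚ-∷ʳ q a p))

  *ₚ-cong : ∀ {p p′ q q′} → p ≈ₚ p′ → q ≈ₚ q′ → p *ₚ q ≈ₚ p′ *ₚ q′
  *ₚ-cong {p} {p′} {q} {q′} e f = begin
    p *ₚ q     ≈⟨ *ₚ-congˡ p f ⟩
    p *ₚ q′    ≈⟨ *ₚ-comm p q′ ⟩
    q′ *ₚ p    ≈⟨ *ₚ-congˡ q′ e ⟩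
    q′ *ₚ p′   ≈⟨ *ₚ-comm q′ p′ ⟩
    p′ *ₚ q′   ∎
    where open ≈ₚ-Reasoning

  *ₚ-distribˡ : ∀ p q r → p *ₚ (q +ₚ r) ≈ₚ p *ₚ q +ₚ p *ₚ r
  *ₚ-distribˡ []      q r = ≈ₚ-refl
  *ₚ-distribˡ (a ∷ p) q r = begin
    a · (q +ₚ r) +ₚ (0# ∷ p *ₚ (q +ₚ r))
      ≈⟨ +ₚ-cong (·-distribˡ a q r) (∷-cong (symᴬ (+-identityʳ 0#)) (*ₚ-distribˡ p q r)) ⟩
    (a · q +ₚ a · r) +ₚ ((0# ∷ p *ₚ q) +ₚ (0# ∷ p *ₚ r))
      ≈⟨ +ₚ-interchange (a · q) (a · r) _ _ ⟩
    (a · q +ₚ (0# ∷ p *ₚ q)) +ₚ (a · r +ₚ (0# ∷ p *ₚ r)) ∎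
    where open ≈ₚ-Reasoning

  *ₚ-distribʳ : ∀ p q r → (q +ₚ r) *ₚ p ≈ₚ q *ₚ p +ₚ r *ₚ p
  *ₚ-distribʳ p q r = begin
    (q +ₚ r) *ₚ p         ≈⟨ *ₚ-comm (q +ₚ r) p ⟩
    p *ₚ (q +ₚ r)         ≈⟨ *ₚ-distribˡ p q r ⟩
    p *ₚ q +ₚ p *ₚ r      ≈⟨ +ₚ-cong (*ₚ-comm p q) (*ₚ-comm p r) ⟩
    q *ₚ p +ₚ r *ₚ p      ∎
    where open ≈ₚ-Reasoning

  0∷-*ₚ : ∀ p q → (0# ∷ p) *ₚ q ≈ₚ 0# ∷ p *ₚ q
  0∷-*ₚ p q = +ₚ-cong (·-zeroˡ q) ≈ₚ-refl

  ·-*ₚ : ∀ a p q → (a · p) *ₚ q ≈ₚ a · (p *ₚ q)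
  ·-*ₚ a []      q = ≈ₚ-refl
  ·-*ₚ a (b ∷ p) q = begin
    (a ⊗ b) · q +ₚ (0# ∷ (a · p) *ₚ q)
      ≈⟨ +ₚ-cong (≈ₚ-sym (·-assoc a b q)) (∷-cong (symᴬ (zeroʳ a)) (·-*ₚ a p q)) ⟩
    a · (b · q) +ₚ a · (0# ∷ p *ₚ q)
      ≈⟨ ·-distribˡ a (b · q) (0# ∷ p *ₚ q) ⟨
    a · (b · q +ₚ (0# ∷ p *ₚ q)) ∎
    where open ≈ₚ-Reasoning

  *ₚ-assoc : ∀ p q r → (p *ₚ q) *ₚ r ≈ₚ p *ₚ (q *ₚ r)
  *ₚ-assoc []      q r = ≈ₚ-refl
  *ₚ-assoc (a ∷ p) q r = begin
    (a · q +ₚ (0# ∷ p *ₚ q)) *ₚ r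
      ≈⟨ *ₚ-distribʳ r (a · q) (0# ∷ p *ₚ q) ⟩
    (a · q) *ₚ r +ₚ (0# ∷ p *ₚ q) *ₚ r
      ≈⟨ +ₚ-cong (·-*ₚ a q r) (0∷-*ₚ (p *ₚ q) r) ⟩
    a · (q *ₚ r) +ₚ (0# ∷ (p *ₚ q) *ₚ r)
      ≈⟨ +ₚ-cong ≈ₚ-refl (∷-cong reflᴬ (*ₚ-assoc p q r)) ⟩
    a · (q *ₚ r) +ₚ (0# ∷ p *ₚ (q *ₚ r)) ∎
    where open ≈ₚ-Reasoning

  *ₚ-identityˡ : ∀ p → const 1# *ₚ p ≈ₚ p
  *ₚ-identityˡ p = begin
    1# · p +ₚ (0# ∷ [])   ≈⟨ +ₚ-cong (·-identityˡ p) 0∷[]≈[] ⟩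
    p +ₚ []               ≈⟨ +ₚ-identityʳ p ⟩
    p                     ∎
    where open ≈ₚ-Reasoning

  *ₚ-identityʳ : ∀ p → p *ₚ const 1# ≈ₚ p
  *ₚ-identityʳ p = ≈ₚ-trans (*ₚ-comm p (const 1#)) (*ₚ-identityˡ p)

  isCommutativeRing : IsCommutativeRing _≈ₚ_ _+ₚ_ _*ₚ_ -ₚ_ [] (const 1#)
  isCommutativeRing = record
    { isRing = record
      { +-isAbelianGroup = record
        { isGroup = record
          { isMonoid = record
            { isSemigroup = record
              { isMagma = record
                { isEquivalence = ≈ₚ-isEquivalence ; ∙-cong = +ₚ-cong }
              ; assoc = +ₚ-assoc }
            ; identity = (λ _ → ≈ₚ-refl) , +ₚ-identityʳ }
          ; inverse = -ₚ-inverseˡ , -ₚ-inverseʳ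
          ; ⁻¹-cong = -ₚ-cong }
        ; comm = +ₚ-comm }
      ; *-cong = *ₚ-cong
      ; *-assoc = *ₚ-assoc
      ; *-identity = *ₚ-identityˡ , *ₚ-identityʳ
      ; distrib = *ₚ-distribˡ , *ₚ-distribʳ }
    ; *-comm = *ₚ-comm }

  polynomialRing : CommutativeRing c ℓ
  polynomialRing = record { isCommutativeRing = isCommutativeRing }

module Factorization (R : CommutativeRing c ℓ) where

  open CommutativeRing R using (Carrier; _≈_; _*_; 1#; semiring)
  open RawSemiringDefs (Semiring.rawSemiring semiring) public using (_∣_; _∤_; Irreducible; product)

  Reducible : Carrier → Set (c ⊔ ℓ)
  Reducible p = ∃₂ λ g h → g ∤ 1# × h ∤ 1# × p ≈ g * h

  -- In a unique factorization domain the number n is determined by p ≠ 0: it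
  -- is the number of irreducible factors of p, counted with multiplicity.
  record IrreducibleFactorization (p : Carrier) (n : ℕ) : Set (c ⊔ ℓ) where
    field
      unit        : Carrier
      unit∣1      : unit ∣ 1#
      factor      : Vector Carrier n
      irreducible : ∀ (i : Fin n) → Irreducible (factor i)
      equality    : p ≈ unit * product factor

  ProductOfAtMost : ℕ → Carrier → Set (c ⊔ ℓ)
  ProductOfAtMost k p =
    (∃ λ n → IrreducibleFactorization p n) ×
    (∀ n → IrreducibleFactorization p n → n ℕ.≤ k)

module BivariatePolynomials (K : Field c ℓ) where

  module K[x] where
    open Polynomials (Field.commutativeRing K) public
      using (HasDegree; _deg<_; Constant; polynomialRing)
    open CommutativeRing polynomialRing public using (Carrier; _≈_; _*_; 0#)
    open Factorization polynomialRing public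

    SmallestIrreducibleFactor : Carrier → Carrier → Set (c ⊔ ℓ)
    SmallestIrreducibleFactor q p =
      Irreducible q × q ∣ p ×
      (∀ r → Irreducible r → r ∣ p →
       ∀ d e → HasDegree q d → HasDegree r e → d ℕ.≤ e)

    -- deg r ≥ deg p − deg q for nonzero p, q, r with deg q ≤ deg p.
    DegreeGap : Carrier → Carrier → Carrier → Set ℓ
    DegreeGap r p q = ∃ λ dᵣ → ∃ λ dₚ → ∃ λ d_q →
      HasDegree r dᵣ × HasDegree p dₚ × HasDegree q d_q × dₚ ℕ.∸ d_q ℕ.≤ dᵣ

  module K[x,y] where
    open Polynomials K[x].polynomialRing public using (const; polynomialRing)
    open CommutativeRing polynomialRing public using (Carrier)
    open Factorization polynomialRing public

    NoNonconstantFactorIn-K[x] : Carrier → Set (c ⊔ ℓ)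
    NoNonconstantFactorIn-K[x] f = ∀ g → const g ∣ f → K[x].Constant g

{-# OPTIONS --safe #-}
module Submission where

open import Algebra.Bundles using (CommutativeRing; Monoid)
open import Algebra.Definitions.RawMagma using (_,_)
open import Algebra.Morphism.Structures using (module MonoidMorphisms)
import Algebra.Properties.CommutativeSemigroup as CommutativeSemigroupProperties
import Algebra.Properties.CommutativeSemigroup.Divisibility as Divisibility
import Algebra.Properties.Semiring.Divisibility as SemiringDivisibility
import Algebra.Properties.Semiring.Primality as Primality
import Algebra.Properties.Ring as RingProperties
import Algebra.Solver.Ring.NaturalCoefficients.Default as RingSolver
open import Axiom.ExcludedMiddle using (ExcludedMiddle)
open import Data.Fin.Base using (Fin; zero; suc; fromℕ; fromℕ<; toℕ)
open import Data.Fin.Properties using (toℕ-fromℕ; toℕ-fromℕ<)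
open import Data.List.Base using ([]; _∷_; length; tabulate)
open import Data.Nat.Base as ℕ using (ℕ; zero; suc; _≤_; _<_; _⊓_; z≤n; s≤s)
open import Data.Nat.Induction using (<-wellFounded; Acc; acc)
import Data.Nat.Properties as ℕₚ
open import Data.Product.Base using (_×_; _,_; ∃; ∃₂; proj₁; proj₂)
open import Data.Sum.Base using (_⊎_; inj₁; inj₂; [_,_]′)
import Data.Vec.Functional as Vector
open import Defs
open import Function.Base using (_∘_; id; case_of_)
open import Level using (Level; _⊔_; lift; lower; Lift)
open import Relation.Binary.Definitions using (tri<; tri≈; tri>)
open import Relation.Binary.PropositionalEquality.Core as ≡ using (_≡_; _≢_)
import Relation.Binary.Reasoning.Setoid as SetoidReasoning
open import Relation.Nullary.Decidable.Core using (Dec; yes; no; map′; decidable-stable)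
open import Relation.Nullary.Negation.Core using (¬_; contradiction)
open import Relation.Unary using (Decidable; Pred)

-- Call the end coefficient of f of strictly largest x-degree the dominant end
-- (a₀ in case (i), aₙ in case (ii)).  For f = g h, the first and the last
-- coefficients of maximal x-degree of f are products of those of g and h, so
-- uniqueness of the maximal coefficient passes to g: the dominant end of every
-- nonunit factor g strictly exceeds the other end in degree, hence is not
-- constant.  As a nonconstant divisor of the dominant end of f it has degree at
-- least deg q; if f = g h with both factors nonunit, the degree hypothesis then
-- leaves too little room for the other end of g to be constant.  So
-- taking either end coefficient turns a product of k nonunits into a product of
-- k nonunits of K[x], and unique factorization in K[x] bounds k.

private
  variable
    c ℓ s t : Level

-- Extremal elements of decidable sets of natural numbers.

greatest : {P : Pred ℕ t} → Decidable P → ∀ N → (∀ j → N ≤ j → ¬ P j) →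
           ∃ P → ∃ λ m → P m × (∀ j → m < j → ¬ P j)
greatest P? zero    P<N (i , Pi) = contradiction Pi (P<N i z≤n)
greatest P? (suc N) P<N ∃P with P? N
... | yes PN = N , PN , P<N
... | no ¬PN = greatest P? N (λ j N≤j Pj → case ℕₚ.m≤n⇒m<n∨m≡n N≤j of λ where
  (inj₁ N<j)    → P<N j N<j Pj
  (inj₂ ≡.refl) → ¬PN Pj) ∃P

least : {P : Pred ℕ t} → Decidable P → ∃ P → ∃ λ m → P m × (∀ j → j < m → ¬ P j)
least P? (i , Pi) = go P? i Pi
  where
  go : {P : Pred ℕ t} → Decidable P → ∀ i → P i → ∃ λ m → P m × (∀ j → j < m → ¬ P j)
  go P? zero    P0 = zero , P0 , λ _ ()
  go P? (suc i) Pi with P? zero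
  ... | yes P0 = zero , P0 , λ _ ()
  ... | no ¬P0 with go (P? ∘ suc) i Pi
  ...   | m , Pm , min = suc m , Pm , λ where
    zero    _         → ¬P0
    (suc j) (s≤s j<m) → min j j<m

-- Counting factors in commutative rings.

NoZeroDivisors : CommutativeRing c ℓ → Set (c ⊔ ℓ)
NoZeroDivisors R = ∀ {x y} → x ≉ 0# → y ≉ 0# → x * y ≉ 0#
  where open CommutativeRing R

module Factors (R : CommutativeRing c ℓ) where

  open CommutativeRing R hiding (zero)
  open Factorization R
  open SemiringDivisibility semiring using (∣ʳ-trans; ∣ʳ-respʳ-≈; ∣ʳ-respˡ-≈; ∣ʳ-refl; x∣ʳy⇒x∣ʳzy) public
  open Divisibility *-commutativeSemigroup using (∙-cong-∣) public
  open CommutativeSemigroupProperties *-commutativeSemigroup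
    using (x∙yz≈y∙xz)
  open Primality semiring using (Prime; mkPrime; mkIrred)

  -- An inductive counterpart of `IrreducibleFactorization` with the predicate on factors left open:
  -- an end coefficient of an irreducible polynomial need not be irreducible, so products of mere
  -- nonunits have to be counted too. The unit sits at the base and does not contribute to the
  -- length.
  data ProductOf (P : Pred Carrier t) : ℕ → Carrier → Set (c ⊔ ℓ ⊔ t) where
    unit : ∀ {p} → p ∣ 1# → ProductOf P 0 p
    cons : ∀ {n g p r} → P g → ProductOf P n p → r ≈ g * p → ProductOf P (suc n) r

  NonUnit : Pred Carrier (c ⊔ ℓ)
  NonUnit p = p ∤ 1#

  unit-* : ∀ {x y} → x ∣ 1# → y ∣ 1# → x * y ∣ 1#
  unit-* x∣1 y∣1 = ∣ʳ-respʳ-≈ (*-identityʳ 1#) (∙-cong-∣ x∣1 y∣1)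

  ∣-*ˡ : ∀ {r x y} → r ≈ x * y → x ∣ r
  ∣-*ˡ {y = y} r≈xy = y , trans (*-comm _ _) (sym r≈xy)

  ∣-*ʳ : ∀ {r x y} → r ≈ x * y → y ∣ r
  ∣-*ʳ {x = x} r≈xy = x , sym r≈xy

  module _ {P : Pred Carrier t} where

    unit-*-ProductOf : ∀ {n u p r} → u ∣ 1# → ProductOf P n p → r ≈ u * p → ProductOf P n r
    unit-*-ProductOf u∣1 (unit p∣1) r≈up = unit (∣ʳ-respˡ-≈ (sym r≈up) (unit-* u∣1 p∣1))
    unit-*-ProductOf u∣1 (cons Pg Πp p≈gs) r≈up =
      cons Pg (unit-*-ProductOf u∣1 Πp refl)
           (trans r≈up (trans (*-congˡ p≈gs) (x∙yz≈y∙xz _ _ _)))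

    *-ProductOf : ∀ {m n p q r} → ProductOf P m p → ProductOf P n q → r ≈ p * q →
                  ProductOf P (m ℕ.+ n) r
    *-ProductOf (unit p∣1) Πq r≈pq = unit-*-ProductOf p∣1 Πq r≈pq
    *-ProductOf (cons Pg Πs p≈gs) Πq r≈pq =
      cons Pg (*-ProductOf Πs Πq refl)
           (trans r≈pq (trans (*-congʳ p≈gs) (*-assoc _ _ _)))

  module _ {P : Pred Carrier t} {s} {Q : Pred Carrier s} where

    mapProductOf : ∀ {n p} → (∀ {g} → P g → Q g) → ProductOf P n p → ProductOf Q n p
    mapProductOf P⇒Q (unit p∣1)         = unit p∣1
    mapProductOf P⇒Q (cons Pg Πp r≈gp) = cons (P⇒Q Pg) (mapProductOf P⇒Q Πp) r≈gp

  fromFactorization : ∀ {n p} → IrreducibleFactorization p n → ProductOf Irreducible n p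
  fromFactorization F = go _ F.unit∣1 F.factor F.irreducible F.equality
    where
    module F = IrreducibleFactorization F
    go : ∀ n {u p} → u ∣ 1# → (g : Vector.Vector Carrier n) → (∀ i → Irreducible (g i)) →
         p ≈ u * product g → ProductOf Irreducible n p
    go zero    u∣1 g irr p≈ = unit (∣ʳ-respˡ-≈ (sym (trans p≈ (*-identityʳ _))) u∣1)
    go (suc n) u∣1 g irr p≈ =
      cons (irr zero) (go n u∣1 (g ∘ suc) (irr ∘ suc) refl) (trans p≈ (x∙yz≈y∙xz _ _ _))

  toFactorization : ∀ {n p} → ProductOf Irreducible n p → IrreducibleFactorization p n
  toFactorization {p = p} (unit p∣1) = record
    { unit = p ; unit∣1 = p∣1 ; factor = λ () ; irreducible = λ ()
    ; equality = sym (*-identityʳ p) }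
  toFactorization (cons {g = g} irr Πp r≈gp) = record
    { unit        = F.unit
    ; unit∣1      = F.unit∣1
    ; factor      = g Vector.∷ F.factor
    ; irreducible = λ where
        zero    → irr
        (suc i) → F.irreducible i
    ; equality    = trans r≈gp (trans (*-congˡ F.equality) (x∙yz≈y∙xz _ _ _))
    }
    where module F = IrreducibleFactorization (toFactorization Πp)

  module _ (noZeroDivisors : NoZeroDivisors R) (_≟0 : ∀ x → Dec (x ≈ 0#)) where

    *-cancelˡ : ∀ {q x y} → q ≉ 0# → q * x ≈ q * y → x ≈ y
    *-cancelˡ {q} {x} {y} q≉0 qx≈qy = x-y≈0⇒x≈y (decidable-stable ((x - y) ≟0)
      λ x-y≉0 → noZeroDivisors q≉0 x-y≉0 (begin
        q * (x - y)           ≈⟨ distribˡ q x (- y) ⟩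
        q * x + q * (- y)     ≈⟨ +-cong qx≈qy (sym (-‿distribʳ-* q y)) ⟩
        q * y - q * y         ≈⟨ -‿inverseʳ _ ⟩
        0#                    ∎))
      where
      open SetoidReasoning setoid
      open RingProperties ring using (-‿distribʳ-*; x∙y⁻¹≈ε⇒x≈y)
      x-y≈0⇒x≈y : x - y ≈ 0# → x ≈ y
      x-y≈0⇒x≈y = x∙y⁻¹≈ε⇒x≈y x y

    module _ (em : ExcludedMiddle (c ⊔ ℓ)) where

      -- The prime divides one of the nonunits, and dividing it out of that one leaves a cofactor
      -- `e`. A unit `e` is absorbed by the remaining product, which costs one factor; a nonunit `e`
      -- takes the place of the old factor.
      cancel-prime : ∀ {k q p r} → Prime q → ProductOf NonUnit k r → r ≈ q * p →
                     ∃ λ k′ → k ≤ suc k′ × ProductOf NonUnit k′ p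
      cancel-prime (mkPrime _ q∤1 _) (unit r∣1) r≈qp =
        contradiction (∣ʳ-trans (∣-*ˡ r≈qp) r∣1) q∤1
      cancel-prime {q = q} {p} prime@(mkPrime q≉0 _ split-∣) (cons {g = g} {p = s} g∤1 Πs r≈gs) r≈qp
        with split-∣ (∣ʳ-respʳ-≈ r≈gs (∣-*ˡ r≈qp))
      ... | inj₁ (e , eq≈g) = case em of λ where
              (yes e∣1) → _ , ℕₚ.≤-refl , unit-*-ProductOf e∣1 Πs p≈es
              (no  e∤1) → _ , ℕₚ.n≤1+n _ , cons e∤1 Πs p≈es
        where
        open SetoidReasoning setoid
        p≈es : p ≈ e * s
        p≈es = *-cancelˡ q≉0 (begin
          q * p          ≈⟨ trans (sym r≈qp) r≈gs ⟩
          g * s          ≈⟨ *-congʳ eq≈g ⟨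
          (e * q) * s    ≈⟨ *-congʳ (*-comm e q) ⟩
          (q * e) * s    ≈⟨ *-assoc q e s ⟩
          q * (e * s)    ∎)
      ... | inj₂ (e , eq≈s) with cancel-prime prime Πs (sym (trans (*-comm q e) eq≈s))
      ...   | k′ , k≤1+k′ , Πe = suc k′ , s≤s k≤1+k′ , cons g∤1 Πe (*-cancelˡ q≉0 (begin
          q * p          ≈⟨ trans (sym r≈qp) r≈gs ⟩
          g * s          ≈⟨ *-congˡ eq≈s ⟨
          g * (e * q)    ≈⟨ *-assoc g e q ⟨
          (g * e) * q    ≈⟨ *-comm _ q ⟩
          q * (g * e)    ∎))
        where open SetoidReasoning setoid

      -- The irreducible factors are cancelled in turn, each at the cost of at most one nonunit;
      -- once only a unit is left, no nonunit can remain.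
      ProductOf-length : (∀ {q} → Irreducible q → Prime q) → ∀ {n k p} →
                         ProductOf Irreducible n p → ProductOf NonUnit k p → k ≤ n
      ProductOf-length irr⇒prime (unit p∣1) (unit _)           = z≤n
      ProductOf-length irr⇒prime (unit p∣1) (cons g∤1 _ p≈gs) =
        contradiction (∣ʳ-trans (∣-*ˡ p≈gs) p∣1) g∤1
      ProductOf-length irr⇒prime (cons irr Πs p≈qs) Πp
        with cancel-prime (irr⇒prime irr) Πp p≈qs
      ... | k′ , k≤1+k′ , Πs′ =
        ℕₚ.≤-trans k≤1+k′ (s≤s (ProductOf-length irr⇒prime Πs Πs′))

  module _ (em : ExcludedMiddle (c ⊔ ℓ)) where

    ¬Reducible⇒Irreducible : ∀ {p} → p ∤ 1# → ¬ Reducible p → Irreducible p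
    ¬Reducible⇒Irreducible {p} p∤1 ¬red = mkIrred p∤1 split
      where
      split : ∀ {x y} → p ≈ x * y → x ∣ 1# ⊎ y ∣ 1#
      split {x} {y} p≈xy with em {x ∣ 1#} | em {y ∣ 1#}
      ... | yes x∣1 | _       = inj₁ x∣1
      ... | no _    | yes y∣1 = inj₂ y∣1
      ... | no x∤1  | no y∤1  = contradiction (x , y , x∤1 , y∤1 , p≈xy) ¬red

    -- Well-founded recursion on a measure. It is a relation `M` because degrees are relational and
    -- because it can then carry an invariant as well, such as dividing a fixed polynomial.
    factorize : (M : ℕ → Pred Carrier t) →
      (∀ {n p x y} → M n p → x ∤ 1# → y ∤ 1# → p ≈ x * y →
        (∃ λ i → i < n × M i x) × (∃ λ j → j < n × M j y)) →
      ∀ {n p} → M n p → ∃ λ k → ProductOf Irreducible k p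
    factorize M split = go (<-wellFounded _)
      where
      go : ∀ {n p} → Acc _<_ n → M n p → ∃ λ k → ProductOf Irreducible k p
      go {p = p} (acc rs) Mp with em {p ∣ 1#}
      ... | yes p∣1 = 0 , unit p∣1
      ... | no  p∤1 with em {Reducible p}
      ...   | no ¬red = 1 , cons (¬Reducible⇒Irreducible p∤1 ¬red) (unit ∣ʳ-refl) (sym (*-identityʳ p))
      ...   | yes (x , y , x∤1 , y∤1 , p≈xy) with split Mp x∤1 y∤1 p≈xy
      ...     | (i , i<n , Mx) , (j , j<n , My) =
        _ , *-ProductOf (proj₂ (go (rs i<n) Mx)) (proj₂ (go (rs j<n) My)) p≈xy

-- Coefficients and degrees of products.

module Coefficients (R : CommutativeRing c ℓ) where

  open CommutativeRing R hiding (zero)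
  open Polynomials R
  open CommutativeSemigroupProperties +-commutativeSemigroup using (x∙yz≈y∙xz)
  private module P = CommutativeRing polynomialRing

  -- `S` collects the negligible terms of a convolution: zero alone when degrees in one variable are
  -- computed, polynomials of bounded x-degree when the coefficients are themselves polynomials.
  module _ {S : Pred Carrier s} (S-resp : ∀ {x y} → x ≈ y → S x → S y)
           (S-0 : S 0#) (S-+ : ∀ {x y} → S x → S y → S (x + y)) where

    coeff-*-∈ : ∀ p q k → (∀ i j → i ℕ.+ j ≡ k → S (coeff p i * coeff q j)) →
                S (coeff (p *ₚ q) k)
    coeff-*-∈ []      q k terms = S-0
    coeff-*-∈ (a ∷ p) q k terms =
      S-resp (sym (coeff-+ (a · q) (0# ∷ p *ₚ q) k))
        (S-+ (S-resp (sym (coeff-· a q k)) (terms 0 k ≡.refl)) (shifted k terms))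
      where
      shifted : ∀ k → (∀ i j → i ℕ.+ j ≡ k → S (coeff (a ∷ p) i * coeff q j)) →
                S (coeff (0# ∷ p *ₚ q) k)
      shifted zero    terms = S-0
      shifted (suc k) terms =
        coeff-*-∈ p q k (λ i j i+j≡k → terms (suc i) j (≡.cong suc i+j≡k))

    -- Used to read off a coefficient of a product from a single term when all the other terms are
    -- negligible.
    coeff-*-+ : ∀ p q i j →
      (∀ i′ j′ → i′ ℕ.+ j′ ≡ i ℕ.+ j → i′ ≢ i → S (coeff p i′ * coeff q j′)) →
      ∃ λ e → S e × coeff (p *ₚ q) (i ℕ.+ j) ≈ coeff p i * coeff q j + e
    coeff-*-+ [] q i j terms = 0# , S-0 , sym (trans (+-identityʳ _) (zeroˡ _))
    coeff-*-+ (a ∷ p) q zero j terms =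
      coeff (0# ∷ p *ₚ q) j , shifted j terms ,
      trans (coeff-+ (a · q) (0# ∷ p *ₚ q) j) (+-congʳ (coeff-· a q j))
      where
      shifted : ∀ j → (∀ i′ j′ → i′ ℕ.+ j′ ≡ j → i′ ≢ 0 → S (coeff (a ∷ p) i′ * coeff q j′)) →
                S (coeff (0# ∷ p *ₚ q) j)
      shifted zero    terms = S-0
      shifted (suc j) terms =
        coeff-*-∈ p q j (λ i′ j′ e → terms (suc i′) j′ (≡.cong suc e) λ ())
    coeff-*-+ (a ∷ p) q (suc i) j terms
      with coeff-*-+ p q i j (λ i′ j′ e i′≢i →
             terms (suc i′) j′ (≡.cong suc e) (i′≢i ∘ ℕₚ.suc-injective))
    ... | e , Se , eq = a * coeff q (suc (i ℕ.+ j)) + e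
      , S-+ (terms 0 _ ≡.refl λ ()) Se
      , trans (coeff-+ (a · q) (0# ∷ p *ₚ q) (suc (i ℕ.+ j)))
              (trans (+-cong (coeff-· a q _) eq) (x∙yz≈y∙xz _ _ _))

  -- A strict degree bound that also covers the zero polynomial, which has no degree in the sense of
  -- `HasDegree`; `Below (suc d)` expresses degree at most `d`.
  Below : ℕ → Polynomial → Set ℓ
  Below d p = ∀ i → d ≤ i → coeff p i ≈ 0#

  Below-resp : ∀ {d p q} → p ≈ₚ q → Below d p → Below d q
  Below-resp p≈q p<d i d≤i = trans (sym (coeff-≈ p≈q i)) (p<d i d≤i)

  Below-mono : ∀ p {d e} → d ≤ e → Below d p → Below e p
  Below-mono p d≤e p<d i e≤i = p<d i (ℕₚ.≤-trans d≤e e≤i)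

  Below-+ : ∀ {d} p q → Below d p → Below d q → Below d (p +ₚ q)
  Below-+ p q p<d q<d i d≤i =
    trans (coeff-+ p q i) (trans (+-cong (p<d i d≤i) (q<d i d≤i)) (+-identityʳ 0#))

  Below-pred : ∀ p {d} → Below (suc d) p → coeff p d ≈ 0# → Below d p
  Below-pred p p≤d pd≈0 i d≤i with ℕₚ.m≤n⇒m<n∨m≡n d≤i
  ... | inj₁ d<i    = p≤d i d<i
  ... | inj₂ ≡.refl = pd≈0

  Below-0 : ∀ {p} → Below 0 p → p ≈ₚ []
  Below-0 p<0 .coeff-≈ i = p<0 i z≤n

  Below-length : ∀ p → Below (length p) p
  Below-length []      i       _         = refl
  Below-length (a ∷ p) (suc i) (s≤s l≤i) = Below-length p i l≤i

  -- In a term of total index at least `d + e`, an index below `d` on the left forces an index above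
  -- `e` on the right.
  Below-* : ∀ {d e} p q → Below d p → Below (suc e) q → Below (d ℕ.+ e) (p *ₚ q)
  Below-* {d} {e} p q p<d q≤e k d+e≤k =
    coeff-*-∈ {S = _≈ 0#} (λ x≈y → trans (sym x≈y)) refl
      (λ x≈0 y≈0 → trans (+-cong x≈0 y≈0) (+-identityʳ 0#)) p q k λ i j i+j≡k →
      case ℕₚ.≤-<-connex d i of λ where
        (inj₁ d≤i) → trans (*-congʳ (p<d i d≤i)) (zeroˡ _)
        (inj₂ i<d) → trans (*-congˡ (q≤e j (ℕₚ.+-cancelˡ-< i e j (ℕₚ.<-≤-trans
                       (ℕₚ.+-monoˡ-< e i<d) (≡.subst (d ℕ.+ e ≤_) (≡.sym i+j≡k) d+e≤k))))) (zeroʳ _)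

  coeff-*-top : ∀ {d e} p q → Below (suc d) p → Below (suc e) q →
                coeff (p *ₚ q) (d ℕ.+ e) ≈ coeff p d * coeff q e
  coeff-*-top {d} {e} p q p≤d q≤e
    with coeff-*-+ {S = _≈ 0#} (λ x≈y → trans (sym x≈y)) refl
           (λ x≈0 y≈0 → trans (+-cong x≈0 y≈0) (+-identityʳ 0#)) p q d e
           (λ i j i+j≡d+e i≢d → case ℕₚ.<-cmp i d of λ where
             (tri< i<d _ _)  → trans (*-congˡ (q≤e j (ℕₚ.+-cancelˡ-< i e j
               (≡.subst (i ℕ.+ e <_) (≡.sym i+j≡d+e) (ℕₚ.+-monoˡ-< e i<d))))) (zeroʳ _)
             (tri≈ _ i≡d _)  → contradiction i≡d i≢d
             (tri> _ _ d<i)  → trans (*-congʳ (p≤d i d<i)) (zeroˡ _))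
  ... | e , e≈0 , eq = trans eq (trans (+-congˡ e≈0) (+-identityʳ _))

  coeff-*-0 : ∀ p q → coeff (p *ₚ q) 0 ≈ coeff p 0 * coeff q 0
  coeff-*-0 []      q = sym (zeroˡ _)
  coeff-*-0 (a ∷ p) q =
    trans (coeff-+ (a · q) (0# ∷ p *ₚ q) 0) (trans (+-identityʳ _) (coeff-· a q 0))

  HasDegree-resp : ∀ {d p q} → p ≈ₚ q → HasDegree p d → HasDegree q d
  HasDegree-resp p≈q (pd≉0 , p≤d) =
    (λ qd≈0 → pd≉0 (trans (coeff-≈ p≈q _) qd≈0)) , Below-resp p≈q p≤d

  HasDegree⇒≉0 : ∀ p {d} → HasDegree p d → ¬ p ≈ₚ []
  HasDegree⇒≉0 p (pd≉0 , _) p≈0 = pd≉0 (coeff-≈ p≈0 _)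

  ≤-degree : ∀ p {d e} → HasDegree p d → coeff p e ≉ 0# → e ≤ d
  ≤-degree p (_ , p≤d) pe≉0 = ℕₚ.≮⇒≥ (pe≉0 ∘ p≤d _)

  degree-unique : ∀ p {d e} → HasDegree p d → HasDegree p e → d ≡ e
  degree-unique p deg-d deg-e =
    ℕₚ.≤-antisym (≤-degree p deg-e (proj₁ deg-d)) (≤-degree p deg-d (proj₁ deg-e))

  degree<bound : ∀ p {d e} → HasDegree p d → Below e p → d < e
  degree<bound p (pd≉0 , _) p<e = ℕₚ.≰⇒> (pd≉0 ∘ p<e _)

  HasDegree-0⇒const : ∀ {p} → HasDegree p 0 → p ≈ₚ const (coeff p 0)
  HasDegree-0⇒const (_ , p≤0) .coeff-≈ zero    = refl
  HasDegree-0⇒const (_ , p≤0) .coeff-≈ (suc i) = p≤0 (suc i) (s≤s z≤n)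

  module _ (_≟0 : ∀ x → Dec (x ≈ 0#)) where

    degree? : ∀ p → p ≈ₚ [] ⊎ ∃ (HasDegree p)
    degree? [] = inj₁ P.refl
    degree? (a ∷ p) with degree? p
    ... | inj₂ (d , pd≉0 , p≤d) = inj₂ (suc d , pd≉0 , λ where
            (suc i) (s≤s d<i) → p≤d i d<i)
    ... | inj₁ p≈0 with a ≟0
    ...   | yes a≈0 = inj₁ (P.trans (∷-cong a≈0 p≈0) 0∷[]≈[])
    ...   | no  a≉0 = inj₂ (0 , a≉0 , λ where (suc i) _ → coeff-≈ p≈0 i)

    degree : ∀ {p} → ¬ p ≈ₚ [] → ∃ (HasDegree p)
    degree {p} p≉0 = [ (λ p≈0 → contradiction p≈0 p≉0) , id ]′ (degree? p)

    -- The value 0 at the zero polynomial makes this a total map, multiplicative on all polynomials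
    -- over a ring without zero divisors.
    lc : Polynomial → Carrier
    lc p = [ (λ _ → 0#) , (λ (d , _) → coeff p d) ]′ (degree? p)

    lc-degree : ∀ p {d} → HasDegree p d → lc p ≈ coeff p d
    lc-degree p p-deg with degree? p
    ... | inj₁ p≈0       = contradiction p≈0 (HasDegree⇒≉0 _ p-deg)
    ... | inj₂ (e , p-e) = reflexive (≡.cong (coeff p) (degree-unique p p-e p-deg))

    lc-zero : ∀ {p} → p ≈ₚ [] → lc p ≈ 0#
    lc-zero {p} p≈0 with degree? p
    ... | inj₁ _         = refl
    ... | inj₂ (d , p-d) = contradiction p≈0 (HasDegree⇒≉0 _ p-d)

    lc-cong : ∀ {p q} → p ≈ₚ q → lc p ≈ lc q
    lc-cong {p} {q} p≈q with degree? p
    ... | inj₁ p≈0       = sym (lc-zero (P.trans (P.sym p≈q) p≈0))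
    ... | inj₂ (d , p-d) = trans (coeff-≈ p≈q d) (sym (lc-degree q (HasDegree-resp p≈q p-d)))

    module _ (noZeroDivisors : NoZeroDivisors R) where

      HasDegree-* : ∀ p q {d e} → HasDegree p d → HasDegree q e → HasDegree (p *ₚ q) (d ℕ.+ e)
      HasDegree-* p q (pd≉0 , p≤d) (qe≉0 , q≤e) =
        noZeroDivisors pd≉0 qe≉0 ∘ trans (sym (coeff-*-top p q p≤d q≤e)) ,
        Below-* p q p≤d q≤e

      *ₚ-noZeroDivisors : NoZeroDivisors polynomialRing
      *ₚ-noZeroDivisors {p} {q} p≉0 q≉0 =
        HasDegree⇒≉0 (p *ₚ q) (HasDegree-* p q (proj₂ (degree p≉0)) (proj₂ (degree q≉0)))

      HasDegree-factors : ∀ {n r} p q → HasDegree r n → r ≈ₚ p *ₚ q →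
        ∃₂ λ d e → HasDegree p d × HasDegree q e × d ℕ.+ e ≡ n
      HasDegree-factors {r = r} p q r-n r≈pq with degree? p | degree? q
      ... | inj₁ p≈0 | _ = contradiction
            (P.trans r≈pq (*ₚ-cong {q = q} p≈0 P.refl)) (HasDegree⇒≉0 r r-n)
      ... | inj₂ _ | inj₁ q≈0 = contradiction
            (P.trans r≈pq (P.trans (*ₚ-congˡ p q≈0) (*ₚ-zeroʳ p))) (HasDegree⇒≉0 r r-n)
      ... | inj₂ (d , p-d) | inj₂ (e , q-e) = d , e , p-d , q-e ,
            degree-unique r (HasDegree-resp (P.sym r≈pq) (HasDegree-* p q p-d q-e)) r-n

      lc-* : ∀ p q → lc (p *ₚ q) ≈ lc p * lc q
      lc-* p q with degree? p | degree? q
      ... | inj₁ p≈0 | _ = trans (lc-zero (*ₚ-cong {q = q} p≈0 P.refl)) (sym (zeroˡ _))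
      ... | inj₂ _ | inj₁ q≈0 =
            trans (lc-zero (P.trans (*ₚ-congˡ p q≈0) (*ₚ-zeroʳ p))) (sym (zeroʳ _))
      ... | inj₂ (d , p-d) | inj₂ (e , q-e) =
            trans (lc-degree (p *ₚ q) (HasDegree-* p q p-d q-e)) (coeff-*-top p q (proj₂ p-d) (proj₂ q-e))

-- Euclidean division and primality of irreducibles in K[x].

module Euclidean (K : Field c ℓ) (_≟0 : ∀ x → Dec (Field._≈_ K x (Field.0# K))) where

  open Field K hiding (zero)
  open Polynomials commutativeRing
  open Coefficients commutativeRing
  open Factors polynomialRing
  open Factorization polynomialRing
  open Primality (CommutativeRing.semiring polynomialRing) using (Prime; mkPrime; mkIrred)
  private module P = CommutativeRing polynomialRing

  noZeroDivisors : NoZeroDivisors commutativeRing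
  noZeroDivisors {x} {y} x≉0 y≉0 xy≈0 with inverse x x≉0
  ... | z , xz≈1 = y≉0 (begin
    y              ≈⟨ *-identityˡ y ⟨
    1# * y         ≈⟨ *-congʳ xz≈1 ⟨
    (x * z) * y    ≈⟨ xy∙z≈y∙xz x z y ⟩
    z * (x * y)    ≈⟨ *-congˡ xy≈0 ⟩
    z * 0#         ≈⟨ zeroʳ z ⟩
    0#             ∎)
    where
    open SetoidReasoning setoid
    open CommutativeSemigroupProperties *-commutativeSemigroup using (xy∙z≈y∙xz)

  K[x]-noZeroDivisors : NoZeroDivisors polynomialRing
  K[x]-noZeroDivisors = *ₚ-noZeroDivisors _≟0 noZeroDivisors

  HasDegree-1 : HasDegree (const 1#) 0
  HasDegree-1 = 1≉0 , λ where (suc i) _ → refl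

  ∣1⇒HasDegree-0 : ∀ {p} → p ∣ const 1# → HasDegree p 0
  ∣1⇒HasDegree-0 {p} (q , qp≈1) with HasDegree-factors _≟0 noZeroDivisors q p HasDegree-1 (P.sym qp≈1)
  ... | zero , zero , _ , p-0 , _ = p-0

  HasDegree-0⇒∣1 : ∀ {p} → HasDegree p 0 → p ∣ const 1#
  HasDegree-0⇒∣1 {p} p-0 with inverse (coeff p 0) (proj₁ p-0)
  ... | v , pv≈1 = const v , P.trans (P.*-congˡ {const v} (HasDegree-0⇒const {p} p-0))
    (∷-cong (trans (+-identityʳ _) (trans (*-comm v _) pv≈1)) P.refl)

  ∤1⇒0<degree : ∀ {p d} → p ∤ const 1# → HasDegree p d → 0 < d
  ∤1⇒0<degree {d = zero}  p∤1 p-d = contradiction (HasDegree-0⇒∣1 p-d) p∤1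
  ∤1⇒0<degree {d = suc d} p∤1 p-d = s≤s z≤n

  0<degree⇒∤1 : ∀ {p d} → HasDegree p d → 0 < d → p ∤ const 1#
  0<degree⇒∤1 {p} p-d 0<d p∣1 =
    ℕₚ.<⇒≢ 0<d (degree-unique p (∣1⇒HasDegree-0 p∣1) p-d)

  -- Recursion on the dividend: if `p = q k + r`, then `a + x p = q (x k) + (a + x r)`, where
  -- `a + x r` has degree at most `d`; subtracting a multiple of `q` removes its coefficient of
  -- index `d`.
  divide : ∀ q {d} → HasDegree q d → ∀ p → ∃₂ λ k r → p ≈ₚ q *ₚ k +ₚ r × Below d r
  divide q q-d [] = [] , [] , P.sym (P.trans (P.+-identityʳ _) (*ₚ-zeroʳ q)) , λ _ _ → refl
  divide q {d} q-d (a ∷ p) with divide q q-d p | inverse (coeff q d) (proj₁ q-d)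
  ... | k , r , p≈qk+r , r<d | v , qv≈1 = b ∷ k , rem , a∷p≈ ,
    Below-pred rem (Below-+ (a ∷ r) (-ₚ (b · q)) (λ where (suc i) (s≤s d≤i) → r<d i d≤i) neg≤d) rem-d≈0
    where
    -- `v` inverts the leading coefficient of `q`, so `b · q` and `a ∷ r` agree at index `d`.
    b = coeff (a ∷ r) d * v
    rem = (a ∷ r) +ₚ (-ₚ (b · q))
    neg-coeff : ∀ i → coeff (-ₚ (b · q)) i ≈ - (b * coeff q i)
    neg-coeff i = trans (coeff-neg (b · q) i) (-‿cong (coeff-· b q i))
    neg≤d : Below (suc d) (-ₚ (b · q))
    neg≤d i d<i = trans (neg-coeff i) (trans (-‿cong
      (trans (*-congˡ (proj₂ q-d i d<i)) (zeroʳ b))) -0#≈0#)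
      where open RingProperties ring using (-0#≈0#)
    bq≈t : b * coeff q d ≈ coeff (a ∷ r) d
    bq≈t = trans (*-assoc _ v _) (trans (*-congˡ (trans (*-comm v _) qv≈1)) (*-identityʳ _))
    rem-d≈0 : coeff rem d ≈ 0#
    rem-d≈0 = trans (coeff-+ (a ∷ r) (-ₚ (b · q)) d)
      (trans (+-congˡ (trans (neg-coeff d) (-‿cong bq≈t))) (-‿inverseʳ _))
    a∷p≈ : a ∷ p ≈ₚ q *ₚ (b ∷ k) +ₚ rem
    a∷p≈ = begin
      a ∷ p
        ≈⟨ ∷-cong (sym (+-identityˡ a)) p≈qk+r ⟩
      (0# ∷ q *ₚ k) +ₚ (a ∷ r)
        ≈⟨ P.+-identityʳ _ ⟨
      ((0# ∷ q *ₚ k) +ₚ (a ∷ r)) +ₚ []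
        ≈⟨ P.+-congˡ {(0# ∷ q *ₚ k) +ₚ (a ∷ r)} (P.-‿inverseʳ (b · q)) ⟨
      ((0# ∷ q *ₚ k) +ₚ (a ∷ r)) +ₚ (b · q +ₚ (-ₚ (b · q)))
        ≈⟨ +ₚ-interchange (0# ∷ q *ₚ k) (a ∷ r) (b · q) (-ₚ (b · q)) ⟩
      ((0# ∷ q *ₚ k) +ₚ b · q) +ₚ rem
        ≈⟨ P.+-congʳ {rem} (P.trans (P.+-comm _ (b · q)) (P.sym (*ₚ-∷ʳ q b k))) ⟩
      q *ₚ (b ∷ k) +ₚ rem ∎
      where open SetoidReasoning P.setoid

  ∣-+ : ∀ {d p q} → d ∣ p → d ∣ q → d ∣ p +ₚ q
  ∣-+ {d} (k , kd≈p) (l , ld≈q) = k +ₚ l , P.trans (*ₚ-distribʳ d k l) (P.+-cong kd≈p ld≈q)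

  -- Euclid's algorithm, with the strict degree bound on `q` as recursion variable. If the
  -- coefficient of `q` just below the bound vanishes, the bound is lowered; otherwise it is the
  -- leading one, and division leaves a remainder with a smaller bound.
  bezout : ∀ n p q → Below n q →
           ∃ λ d → d ∣ p × d ∣ q × ∃₂ λ s t → d ≈ₚ p *ₚ s +ₚ q *ₚ t
  bezout zero p q q<0 = p , ∣ʳ-refl , ([] , P.sym (Below-0 q<0)) , const 1# , [] ,
    P.sym (P.trans (P.+-cong (P.*-identityʳ p) (*ₚ-zeroʳ q)) (P.+-identityʳ p))
  bezout (suc n) p q q≤n with coeff q n ≟0
  ... | yes qn≈0 = bezout n p q (Below-pred q q≤n qn≈0)
  ... | no  qn≉0 with divide q (qn≉0 , q≤n) p
  ...   | k , r , p≈qk+r , r<n with bezout n q r r<n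
  ...     | d , d∣q , d∣r , s , t , d≈qs+rt =
    d , ∣ʳ-respʳ-≈ (P.sym p≈qk+r) (∣-+ (∣ʳ-respʳ-≈ (*ₚ-comm k q) (x∣ʳy⇒x∣ʳzy k d∣q)) d∣r) , d∣q ,
    -- Substituting `r = p - q k` into `d = q s + r t` gives these coefficients of `p` and `q`.
    t , s +ₚ (-ₚ k) *ₚ t , (begin
      d
        ≈⟨ d≈qs+rt ⟩
      q *ₚ s +ₚ r *ₚ t
        ≈⟨ P.+-congˡ {q *ₚ s} (P.*-congʳ {t} r≈) ⟩
      q *ₚ s +ₚ (p +ₚ q *ₚ (-ₚ k)) *ₚ t
        ≈⟨ solve 5 (λ p q s t k → q :* s :+ (p :+ q :* k) :* t := p :* t :+ q :* (s :+ k :* t))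
             P.refl p q s t (-ₚ k) ⟩
      p *ₚ t +ₚ q *ₚ (s +ₚ (-ₚ k) *ₚ t) ∎)
    where
    open SetoidReasoning P.setoid
    open RingSolver P.commutativeSemiring
    r≈ : r ≈ₚ p +ₚ q *ₚ (-ₚ k)
    r≈ = begin
      r                                   ≈⟨ P.+-identityʳ r ⟨
      r +ₚ []                             ≈⟨ P.+-congˡ {r} (*ₚ-zeroʳ q) ⟨
      r +ₚ q *ₚ []                        ≈⟨ P.+-congˡ {r} (*ₚ-congˡ q (P.-‿inverseʳ k)) ⟨
      r +ₚ q *ₚ (k +ₚ (-ₚ k))
        ≈⟨ solve 4 (λ r q k l → r :+ q :* (k :+ l) := (q :* k :+ r) :+ q :* l) P.refl r q k (-ₚ k) ⟩
      (q *ₚ k +ₚ r) +ₚ q *ₚ (-ₚ k)        ≈⟨ P.+-congʳ {q *ₚ (-ₚ k)} p≈qk+r ⟨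
      p +ₚ q *ₚ (-ₚ k)                    ∎

  -- Let `d` be a greatest common divisor of `x` and `q`, with `q = e d`. If `e` is a unit, `q`
  -- divides `d` and hence `x`. If `d` is a unit, multiplying the Bezout identity by `y` shows that
  -- `q` divides `y`.
  irreducible⇒prime : ∀ {q} → Irreducible q → Prime q
  irreducible⇒prime {q} (mkIrred q∤1 split-∣1) = mkPrime q≉0 q∤1 split-∣
    where
    open RingSolver P.commutativeSemiring
    open SetoidReasoning P.setoid
    q≉0 : ¬ q ≈ₚ []
    -- Were `q` zero, it would be the product `0 * 0`, and irreducibility would make zero a unit;
    -- yet units have a nonzero constant coefficient.
    q≉0 q≈0 with split-∣1 {[]} {[]} q≈0
    ... | inj₁ 0∣1 = proj₁ (∣1⇒HasDegree-0 0∣1) refl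
    ... | inj₂ 0∣1 = proj₁ (∣1⇒HasDegree-0 0∣1) refl
    split-∣ : ∀ {x y} → q ∣ x *ₚ y → q ∣ x ⊎ q ∣ y
    split-∣ {x} {y} (z , zq≈xy) with bezout (length q) x q (Below-length q)
    ... | d , d∣x , (e , ed≈q) , s , t , d≈xs+qt with split-∣1 {e} {d} (P.sym ed≈q)
    ... | inj₁ (w , we≈1) = inj₁ (∣ʳ-trans (w , (begin
        w *ₚ q           ≈⟨ *ₚ-congˡ w ed≈q ⟨
        w *ₚ (e *ₚ d)    ≈⟨ *ₚ-assoc w e d ⟨
        w *ₚ e *ₚ d      ≈⟨ P.*-congʳ {d} we≈1 ⟩
        const 1# *ₚ d    ≈⟨ *ₚ-identityˡ d ⟩
        d                ∎)) d∣x)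
    ... | inj₂ (w , wd≈1) = inj₂ (w *ₚ (z *ₚ s +ₚ t *ₚ y) , (begin
        w *ₚ (z *ₚ s +ₚ t *ₚ y) *ₚ q
          ≈⟨ solve 6 (λ w z s t y q → w :* (z :* s :+ t :* y) :* q
               := w :* (z :* q :* s :+ q :* t :* y)) P.refl w z s t y q ⟩
        w *ₚ (z *ₚ q *ₚ s +ₚ q *ₚ t *ₚ y)
          ≈⟨ *ₚ-congˡ w (P.+-congʳ {q *ₚ t *ₚ y} (P.*-congʳ {s} zq≈xy)) ⟩
        w *ₚ (x *ₚ y *ₚ s +ₚ q *ₚ t *ₚ y)
          ≈⟨ solve 6 (λ w x y s q t → w :* (x :* y :* s :+ q :* t :* y)
               := w :* (x :* s :+ q :* t) :* y) P.refl w x y s q t ⟩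
        w *ₚ (x *ₚ s +ₚ q *ₚ t) *ₚ y
          ≈⟨ P.*-congʳ {y} (*ₚ-congˡ w d≈xs+qt) ⟨
        w *ₚ d *ₚ y
          ≈⟨ P.*-congʳ {y} wd≈1 ⟩
        const 1# *ₚ y
          ≈⟨ *ₚ-identityˡ y ⟩
        y ∎))

  splitDegree : ∀ {n p x y} → HasDegree p n → x ∤ const 1# → y ∤ const 1# → p ≈ₚ x *ₚ y →
    (∃ λ i → i < n × HasDegree x i) × (∃ λ j → j < n × HasDegree y j)
  splitDegree {x = x} {y} p-n x∤1 y∤1 p≈xy with HasDegree-factors _≟0 noZeroDivisors x y p-n p≈xy
  ... | i , j , x-i , y-j , ≡.refl =
    (i , ℕₚ.m<m+n i (∤1⇒0<degree y∤1 y-j) , x-i) , (j , ℕₚ.m<n+m j (∤1⇒0<degree x∤1 x-i) , y-j)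

-- Polynomials in two variables and their end coefficients.

module Bivariate (em : ExcludedMiddle (c ⊔ ℓ)) (K : Field c ℓ) where

  open Field K using (commutativeRing)
    renaming ( _≈_ to _≈ᴷ_; 0# to 0ᴷ; _+_ to _+ᴷ_; _*_ to _*ᴷ_; refl to reflᴷ; sym to symᴷ
             ; trans to transᴷ; setoid to setoidᴷ; +-identityʳ to +ᴷ-identityʳ; +-congˡ to +ᴷ-congˡ )

  em-ℓ : ExcludedMiddle ℓ
  em-ℓ {P} = map′ lower lift (em {Lift c P})

  _≟0ᴷ : ∀ x → Dec (x ≈ᴷ 0ᴷ)
  x ≟0ᴷ = em-ℓ

  module X where
    open Polynomials commutativeRing public
    open Coefficients commutativeRing public
    open Euclidean K _≟0ᴷ public
    open Factors polynomialRing public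
    open Factorization polynomialRing public
    open CommutativeRing polynomialRing public using (*-monoid)

  _≟0ˣ : ∀ p → Dec (p X.≈ₚ [])
  x ≟0ˣ = em-ℓ

  module XY where
    open Polynomials X.polynomialRing public
    open Coefficients X.polynomialRing public
    open Factors polynomialRing public
    open Factorization polynomialRing public
    open CommutativeRing polynomialRing public using (*-monoid; refl; sym; trans)
    open MonoidMorphisms (Monoid.rawMonoid *-monoid) (Monoid.rawMonoid X.*-monoid) public
      using (IsMonoidHomomorphism; module IsMonoidHomomorphism)

  open X using (HasDegree; Below; _≈ₚ_; _*ₚ_)
  open XY using (coeff)

  lcʸ : XY.Polynomial → X.Polynomial
  lcʸ = XY.lc _≟0ˣ

  1ˣ : X.Polynomial
  1ˣ = X.const (Field.1# K)

  -- Packaging both end coefficients as multiplicative homomorphisms lets a single counting argument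
  -- serve both cases, with the ends exchanged.
  coeff-0-homomorphism : XY.IsMonoidHomomorphism (λ g → coeff g 0)
  coeff-0-homomorphism = record
    { isMagmaHomomorphism = record
      { isRelHomomorphism = record { cong = λ g≈h → XY.coeff-≈ g≈h 0 }
      ; homo              = XY.coeff-*-0
      }
    ; ε-homo = X.≈ₚ-refl
    }

  lc-homomorphism : XY.IsMonoidHomomorphism lcʸ
  lc-homomorphism = record
    { isMagmaHomomorphism = record
      { isRelHomomorphism = record { cong = XY.lc-cong _≟0ˣ }
      ; homo              = XY.lc-* _≟0ˣ X.K[x]-noZeroDivisors
      }
    ; ε-homo = XY.lc-degree _≟0ˣ (XY.const 1ˣ) {0} (X.HasDegree⇒≉0 1ˣ X.HasDegree-1 , λ where (suc i) _ → X.≈ₚ-refl)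
    }

  -- Coefficients of maximal x-degree.

  record Peak (g : XY.Polynomial) (k d : ℕ) : Set ℓ where
    constructor peak
    field
      at        : HasDegree (coeff g k) d
      elsewhere : ∀ j → j ≢ k → Below d (coeff g j)

  -- The indices `lo` and `hi` are the ends of the edge of the Newton polygon of `g` on which the
  -- exponent of x is maximal; when that edge shrinks to a vertex, `g` has a `Peak`.
  record Extremes (g : XY.Polynomial) : Set ℓ where
    field
      height lo hi : ℕ
      bound : ∀ i → Below (suc height) (coeff g i)
      lo≉0  : ¬ X.coeff (coeff g lo) height ≈ᴷ 0ᴷ
      hi≉0  : ¬ X.coeff (coeff g hi) height ≈ᴷ 0ᴷ
      <lo   : ∀ i → i < lo → Below height (coeff g i)
      >hi   : ∀ i → hi < i → Below height (coeff g i)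

    lo≤hi : lo ≤ hi
    lo≤hi = ℕₚ.≮⇒≥ λ hi<lo → hi≉0 (<lo hi hi<lo height ℕₚ.≤-refl)

  uniformBound : ∀ g → ∃ λ N → ∀ i → Below N (coeff g i)
  uniformBound []      = 0 , λ _ _ _ → reflᴷ
  uniformBound (p ∷ g) with uniformBound g
  ... | N , g<N = length p ℕ.⊔ N , λ where
    zero    → X.Below-mono p (ℕₚ.m≤m⊔n (length p) N) (X.Below-length p)
    (suc i) → X.Below-mono (coeff g i) (ℕₚ.m≤n⊔m (length p) N) (g<N i)

  extremes : ∀ {g} → ¬ g XY.≈ₚ [] → Extremes g
  extremes {g} g≉0 = record
    { height = B
    ; lo     = proj₁ low
    ; hi     = proj₁ high
    ; bound  = bound
    ; lo≉0   = proj₁ (proj₂ low)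
    ; hi≉0   = proj₁ (proj₂ high)
    ; <lo    = λ i i<lo → X.Below-pred (coeff g i) (bound i) (vanish (proj₂ (proj₂ low) i i<lo))
    ; >hi    = λ i hi<i → X.Below-pred (coeff g i) (bound i) (vanish (proj₂ (proj₂ high) i hi<i))
    }
    where
    At : ℕ → Pred ℕ ℓ
    At d i = ¬ X.coeff (coeff g i) d ≈ᴷ 0ᴷ
    vanish : ∀ {d i} → ¬ At d i → X.coeff (coeff g i) d ≈ᴷ 0ᴷ
    vanish = decidable-stable em-ℓ
    N = proj₁ (uniformBound g)
    inhabited : ∃ λ d → ∃ (At d)
    inhabited with XY.degree _≟0ˣ g≉0
    ... | m , gm≉0 , _ with X.degree _≟0ᴷ gm≉0
    ...   | d , gmd≉0 , _ = d , m , gmd≉0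
    -- The maximum is sought over the exponents of x occurring in any coefficient; searches over the
    -- exponents of y at that height then yield `lo` and `hi`.
    max = greatest {P = λ d → ∃ (At d)} (λ _ → em-ℓ) N
      (λ d N≤d (i , gid≉0) → gid≉0 (proj₂ (uniformBound g) i d N≤d)) inhabited
    B = proj₁ max
    bound : ∀ i → Below (suc B) (coeff g i)
    bound i d B<d = vanish λ gid≉0 → proj₂ (proj₂ max) d B<d (i , gid≉0)
    low  = least (λ _ → em-ℓ) (proj₁ (proj₂ max))
    high = greatest (λ _ → em-ℓ) (length g)
      (λ i l≤i giB≉0 → giB≉0 (X.coeff-≈ (XY.Below-length g i l≤i) B)) (proj₁ (proj₂ max))

  -- Every other term of the convolution misses the exponent `B + C` of x because one of its factors
  -- lies below its bound, so what remains there is a product of two nonzero field elements. The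
  -- condition `off` is loose enough for both ends of the Newton edge.
  coeff-corner : ∀ g h B C i j →
    (∀ i → Below (suc B) (coeff g i)) → (∀ j → Below (suc C) (coeff h j)) →
    (∀ i′ j′ → i′ ℕ.+ j′ ≡ i ℕ.+ j → i′ ≢ i → Below B (coeff g i′) ⊎ Below C (coeff h j′)) →
    ¬ X.coeff (coeff g i) B ≈ᴷ 0ᴷ → ¬ X.coeff (coeff h j) C ≈ᴷ 0ᴷ →
    ¬ X.coeff (coeff (g XY.*ₚ h) (i ℕ.+ j)) (B ℕ.+ C) ≈ᴷ 0ᴷ
  coeff-corner g h B C i j g≤B h≤C off giB≉0 hjC≉0
    with XY.coeff-*-+ {S = Below (B ℕ.+ C)} X.Below-resp (λ _ _ → reflᴷ) (λ {x} {y} → X.Below-+ x y) g h i j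
           (λ i′ j′ eq i′≢i → case off i′ j′ eq i′≢i of λ where
             (inj₁ g<B) → X.Below-* (coeff g i′) (coeff h j′) g<B (h≤C j′)
             -- `Below-*` wants the strict bound on its left factor, hence the commuted product.
             (inj₂ h<C) → X.Below-resp (X.*ₚ-comm (coeff h j′) (coeff g i′))
               (≡.subst (λ d → Below d (coeff h j′ *ₚ coeff g i′)) (ℕₚ.+-comm C B)
                 (X.Below-* (coeff h j′) (coeff g i′) h<C (g≤B i′))))
  ... | e , e<B+C , eq = λ ghBC≈0 → X.noZeroDivisors giB≉0 hjC≉0 (begin
    X.coeff (coeff g i) B *ᴷ X.coeff (coeff h j) C
      ≈⟨ X.coeff-*-top (coeff g i) (coeff h j) (g≤B i) (h≤C j) ⟨
    X.coeff (coeff g i *ₚ coeff h j) (B ℕ.+ C)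
      ≈⟨ +ᴷ-identityʳ _ ⟨
    X.coeff (coeff g i *ₚ coeff h j) (B ℕ.+ C) +ᴷ 0ᴷ
      ≈⟨ +ᴷ-congˡ (e<B+C _ ℕₚ.≤-refl) ⟨
    X.coeff (coeff g i *ₚ coeff h j) (B ℕ.+ C) +ᴷ X.coeff e (B ℕ.+ C)
      ≈⟨ X.coeff-+ (coeff g i *ₚ coeff h j) e _ ⟨
    X.coeff (coeff g i *ₚ coeff h j X.+ₚ e) (B ℕ.+ C)
      ≈⟨ X.coeff-≈ eq _ ⟨
    X.coeff (coeff (g XY.*ₚ h) (i ℕ.+ j)) (B ℕ.+ C)
      ≈⟨ ghBC≈0 ⟩
    0ᴷ ∎)
    where open SetoidReasoning setoidᴷ

  -- The first and the last coefficient of maximal x-degree of g h sit at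
  -- lo g + lo h and hi g + hi h.  Both are k, so lo g = hi g.
  Peak-factor : ∀ {f g h k d} → Peak f k d → f XY.≈ₚ g XY.*ₚ h →
                ¬ g XY.≈ₚ [] → ¬ h XY.≈ₚ [] →
                ∃₂ λ i j → i ℕ.+ j ≡ k × ∃ (Peak g i) × ¬ coeff h j ≈ₚ []
  Peak-factor {f} {g} {h} {k} {d} (peak at elsewhere) f≈gh g≉0 h≉0 =
    G.lo , H.lo , lo-sum ,
    (G.height , peak (G.lo≉0 , G.bound G.lo) λ i i≢lo → case ℕₚ.<-cmp i G.lo of λ where
      (tri< i<lo _ _) → G.<lo i i<lo
      (tri≈ _ i≡lo _) → contradiction i≡lo i≢lo
      (tri> _ _ lo<i) → G.>hi i (≡.subst (_< i) lo≡hi lo<i)) ,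
    λ h-lo≈0 → H.lo≉0 (X.coeff-≈ h-lo≈0 _)
    where
    module G = Extremes (extremes g≉0)
    module H = Extremes (extremes h≉0)
    f≤ : Below (suc (G.height ℕ.+ H.height)) (coeff f k)
    f≤ = X.Below-resp (X.≈ₚ-sym (XY.coeff-≈ f≈gh k))
      (XY.coeff-*-∈ {S = Below (suc (G.height ℕ.+ H.height))} X.Below-resp (λ _ _ → reflᴷ)
        (λ {x} {y} → X.Below-+ x y) g h k λ i j _ → X.Below-* (coeff g i) (coeff h j) (G.bound i) (H.bound j))
    -- By `f≤` the sum of the two heights is at least `d`, and at such an exponent every coefficient
    -- of `f` other than the one at `k` vanishes.
    attained⇒≡k : ∀ {i} → ¬ X.coeff (coeff (g XY.*ₚ h) i) (G.height ℕ.+ H.height) ≈ᴷ 0ᴷ → i ≡ k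
    attained⇒≡k {i} top≉0 = decidable-stable (i ℕₚ.≟ k) λ i≢k →
      top≉0 (transᴷ (symᴷ (X.coeff-≈ (XY.coeff-≈ f≈gh i) _))
        (elsewhere i i≢k _ (ℕ.s≤s⁻¹ (X.degree<bound (coeff f k) at f≤))))
    lo-sum : G.lo ℕ.+ H.lo ≡ k
    lo-sum = attained⇒≡k (coeff-corner g h _ _ G.lo H.lo G.bound H.bound
      -- A different pair with the same index sum has one index before the respective `lo`.
      (λ i j i+j≡ i≢lo → case ℕₚ.<-cmp i G.lo of λ where
        (tri< i<lo _ _) → inj₁ (G.<lo i i<lo)
        (tri≈ _ i≡lo _) → contradiction i≡lo i≢lo
        (tri> _ _ lo<i) → inj₂ (H.<lo j (ℕₚ.+-cancelˡ-< i j H.lo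
          (≡.subst (_< i ℕ.+ H.lo) (≡.sym i+j≡) (ℕₚ.+-monoˡ-< H.lo lo<i)))))
      G.lo≉0 H.lo≉0)
    hi-sum : G.hi ℕ.+ H.hi ≡ k
    hi-sum = attained⇒≡k (coeff-corner g h _ _ G.hi H.hi G.bound H.bound
      (λ i j i+j≡ i≢hi → case ℕₚ.<-cmp i G.hi of λ where
        (tri< i<hi _ _) → inj₂ (H.>hi j (ℕₚ.+-cancelˡ-< i H.hi j
          (≡.subst (i ℕ.+ H.hi <_) (≡.sym i+j≡) (ℕₚ.+-monoˡ-< H.hi i<hi))))
        (tri≈ _ i≡hi _) → contradiction i≡hi i≢hi
        (tri> _ _ hi<i) → inj₁ (G.>hi i hi<i))
      G.hi≉0 H.hi≉0)
    lo≡hi : G.lo ≡ G.hi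
    lo≡hi = ℕₚ.≤-antisym G.lo≤hi (ℕₚ.+-cancelʳ-≤ H.lo G.hi G.lo (begin
      G.hi ℕ.+ H.lo    ≤⟨ ℕₚ.+-monoʳ-≤ G.hi H.lo≤hi ⟩
      G.hi ℕ.+ H.hi    ≡⟨ ≡.trans hi-sum (≡.sym lo-sum) ⟩
      G.lo ℕ.+ H.lo    ∎))
      where open ℕₚ.≤-Reasoning

  module _ {E : XY.Polynomial → X.Polynomial} (isHom : XY.IsMonoidHomomorphism E) where
    open XY.IsMonoidHomomorphism isHom

    ∣1-homo : ∀ {g} → g XY.∣ XY.const 1ˣ → E g X.∣ 1ˣ
    ∣1-homo {g} (h , hg≈1) = E h ,
      X.≈ₚ-trans (X.≈ₚ-sym (homo h g)) (X.≈ₚ-trans (⟦⟧-cong hg≈1) ε-homo)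

    -- A nonunit may in general have a unit as its image, so preservation is asked only for divisors
    -- of `f`; the factors of a divisor are again divisors.
    ProductOf-NonUnit-homo : ∀ {f} → (∀ {g} → g XY.∣ f → XY.NonUnit g → X.NonUnit (E g)) →
      ∀ {k p} → p XY.∣ f → XY.ProductOf XY.NonUnit k p → X.ProductOf X.NonUnit k (E p)
    ProductOf-NonUnit-homo E-nonUnit p∣f (XY.unit p∣1) = X.unit (∣1-homo p∣1)
    ProductOf-NonUnit-homo E-nonUnit p∣f (XY.cons {g = g} {s} g∤1 Πs p≈gs) =
      X.cons (E-nonUnit (XY.∣ʳ-trans (XY.∣-*ˡ p≈gs) p∣f) g∤1)
             (ProductOf-NonUnit-homo E-nonUnit (XY.∣ʳ-trans (XY.∣-*ʳ {x = g} p≈gs) p∣f) Πs)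
             (X.≈ₚ-trans (⟦⟧-cong p≈gs) (homo g s))

    ∣-homo : ∀ {g f} → g XY.∣ f → E g X.∣ E f
    ∣-homo {g} (h , hg≈f) = E h , X.≈ₚ-trans (X.≈ₚ-sym (homo h g)) (⟦⟧-cong hg≈f)

  -- Counting factors through the end coefficients.

  -- D f is the end coefficient of f of larger x-degree and O f the other one.
  module Counting
    {D O : XY.Polynomial → X.Polynomial}
    (D-hom : XY.IsMonoidHomomorphism D) (O-hom : XY.IsMonoidHomomorphism O)
    {f : XY.Polynomial}
    (drop : ∀ {g} → g XY.∣ f → XY.NonUnit g →
            ∃₂ λ d e → HasDegree (D g) d × HasDegree (O g) e × e < d)
    (Df-reducible : X.Reducible (D f))
    {q : X.Polynomial} {d_D d_O d_q : ℕ} (q-irreducible : X.Irreducible q)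
    (q-smallest : ∀ r → X.Irreducible r → r X.∣ D f →
                  ∀ d e → HasDegree q d → HasDegree r e → d ≤ e)
    (deg-D : HasDegree (D f) d_D) (deg-O : HasDegree (O f) d_O) (deg-q : HasDegree q d_q)
    (gap : d_D ℕ.∸ d_q ≤ d_O)
    where

    private
      module D = XY.IsMonoidHomomorphism D-hom
      module O = XY.IsMonoidHomomorphism O-hom

    -- The minimality of `q` concerns irreducible factors only; `p` has such a factor `r`, which
    -- also divides `D f` and has degree at most that of `p`.
    d_q≤ : ∀ {p d} → p X.∣ D f → X.NonUnit p → HasDegree p d → d_q ≤ d
    d_q≤ {p} p∣Df p∤1 p-d
      with X.factorize em (λ n r → HasDegree r n)
             (λ r-n x∤1 y∤1 r≈xy → X.splitDegree r-n x∤1 y∤1 r≈xy) p-d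
    ... | _ , X.unit p∣1 = contradiction p∣1 p∤1
    ... | _ , X.cons {g = r} {s} r-irr _ p≈rs
      with X.HasDegree-factors _≟0ᴷ X.noZeroDivisors r s p-d p≈rs
    ...   | i , j , r-i , _ , i+j≡d = ℕₚ.≤-trans
            (q-smallest r r-irr (X.∣ʳ-trans (X.∣-*ˡ p≈rs) p∣Df) _ _ deg-q r-i)
            (≡.subst (i ≤_) i+j≡d (ℕₚ.m≤m+n i j))

    -- d₁ and d₂ stand for the degrees of two complementary factors of D f.
    cofactor≤ : ∀ {d₁ d₂} → d_q ≤ d₁ → d₁ ℕ.+ d₂ ≡ d_D → d₂ ≤ d_O
    cofactor≤ {d₁} {d₂} d_q≤d₁ d₁+d₂≡d_D = begin
      d₂                     ≡⟨ ℕₚ.m+n∸m≡n d₁ d₂ ⟨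
      d₁ ℕ.+ d₂ ℕ.∸ d₁       ≡⟨ ≡.cong (ℕ._∸ d₁) d₁+d₂≡d_D ⟩
      d_D ℕ.∸ d₁             ≤⟨ ℕₚ.∸-monoʳ-≤ d_D d_q≤d₁ ⟩
      d_D ℕ.∸ d_q            ≤⟨ gap ⟩
      d_O                    ∎
      where open ℕₚ.≤-Reasoning

    D-nonUnit : ∀ {g} → g XY.∣ f → XY.NonUnit g → X.NonUnit (D g)
    D-nonUnit g∣f g∤1 with drop g∣f g∤1
    ... | _ , _ , Dg-d , _ , e<d = X.0<degree⇒∤1 Dg-d (ℕₚ.≤-<-trans z≤n e<d)

    -- Reducibility supplies `D f = x y` with nonunits: `x` has degree at least `d_q`, so by the
    -- degree hypothesis `d_O` is at least the degree of `y`, which is positive.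
    0<d_O : 0 < d_O
    0<d_O =
      let x , y , x∤1 , y∤1 , Df≈xy = Df-reducible
          i , j , x-i , y-j , i+j≡d = X.HasDegree-factors _≟0ᴷ X.noZeroDivisors x y deg-D Df≈xy
      in ℕₚ.<-≤-trans (X.∤1⇒0<degree y∤1 y-j) (cofactor≤ (d_q≤ (X.∣-*ˡ Df≈xy) x∤1 x-i) i+j≡d)

    -- With `f = h g`: if `h` is a unit, `O g` has the same positive degree `d_O` as `O f`.
    -- Otherwise the degree drop for `h` and the degree hypothesis give `e₂ < d₂ ≤ d_O = e₂ + e₁`,
    -- so `O g` is not constant.
    O-nonUnit : ∀ {g} → g XY.∣ f → XY.NonUnit g → X.NonUnit (O g)
    O-nonUnit {g} (h , hg≈f) g∤1 with drop (h , hg≈f) g∤1 | em {h XY.∣ XY.const 1ˣ}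
    ... | d₁ , e₁ , Dg-d₁ , Og-e₁ , _ | yes h∣1 = X.0<degree⇒∤1 Og-e₁
      (≡.subst (0 <_) (X.degree-unique (O f) deg-O (X.HasDegree-resp
        (X.≈ₚ-trans (X.≈ₚ-sym (O.homo h g)) (O.⟦⟧-cong hg≈f))
        (X.HasDegree-* _≟0ᴷ X.noZeroDivisors (O h) (O g)
          (X.∣1⇒HasDegree-0 (∣1-homo O-hom h∣1)) Og-e₁))) 0<d_O)
    ... | d₁ , e₁ , Dg-d₁ , Og-e₁ , _ | no h∤1 with drop (g , XY.trans (XY.*ₚ-comm g h) hg≈f) h∤1
    ...   | d₂ , e₂ , Dh-d₂ , Oh-e₂ , e₂<d₂ = X.0<degree⇒∤1 Og-e₁
      (ℕₚ.+-cancelˡ-< e₂ 0 e₁ (begin-strict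
        e₂ ℕ.+ 0     ≡⟨ ℕₚ.+-identityʳ e₂ ⟩
        e₂           <⟨ e₂<d₂ ⟩
        d₂           ≤⟨ cofactor≤ (d_q≤ (∣-homo D-hom (h , hg≈f)) (D-nonUnit (h , hg≈f) g∤1) Dg-d₁)
                          (≡.trans (ℕₚ.+-comm d₁ d₂) (degree-sum D-hom Dh-d₂ Dg-d₁ deg-D)) ⟩
        d_O          ≡⟨ degree-sum O-hom Oh-e₂ Og-e₁ deg-O ⟨
        e₂ ℕ.+ e₁    ∎))
      where
      open ℕₚ.≤-Reasoning
      degree-sum : ∀ {E : XY.Polynomial → X.Polynomial} → XY.IsMonoidHomomorphism E → ∀ {i j k} →
        HasDegree (E h) i → HasDegree (E g) j → HasDegree (E f) k → i ℕ.+ j ≡ k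
      degree-sum {E} E-hom Eh-i Eg-j Ef-k = X.degree-unique (E f) (X.HasDegree-resp
        (X.≈ₚ-trans (X.≈ₚ-sym (E.homo h g)) (E.⟦⟧-cong hg≈f))
        (X.HasDegree-* _≟0ᴷ X.noZeroDivisors (E h) (E g) Eh-i Eg-j)) Ef-k
        where module E = XY.IsMonoidHomomorphism E-hom

    factorCount≤ : ∀ {E : XY.Polynomial → X.Polynomial} → XY.IsMonoidHomomorphism E →
      (∀ {g} → g XY.∣ f → XY.NonUnit g → X.NonUnit (E g)) →
      ∀ {ν k p} → E f ≈ₚ p → X.IrreducibleFactorization p ν → XY.IrreducibleFactorization f k → k ≤ ν
    factorCount≤ {E} E-hom E-nonUnit Ef≈p Fp Ff =
      X.ProductOf-length X.K[x]-noZeroDivisors (λ x → em-ℓ) em X.irreducible⇒prime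
        -- Multiplication by the unit 1 carries the factorization of `p` over to `E f`.
        (X.unit-*-ProductOf X.∣ʳ-refl (X.fromFactorization Fp)
          (X.≈ₚ-trans Ef≈p (X.≈ₚ-sym (X.*ₚ-identityˡ _))))
        (ProductOf-NonUnit-homo E-hom E-nonUnit XY.∣ʳ-refl
          (XY.mapProductOf XY.Irreducible.p∤1 (XY.fromFactorization Ff)))

    productOfAtMost : ∀ {b o μ ν} → D f ≈ₚ b → O f ≈ₚ o →
      X.IrreducibleFactorization b μ → X.IrreducibleFactorization o ν →
      XY.ProductOfAtMost (μ ⊓ ν) f
    productOfAtMost Df≈b Of≈o Fb Fo = (_ , XY.toFactorization (proj₂ exists)) ,
      λ k Ff → ℕₚ.⊓-glb (factorCount≤ D-hom D-nonUnit Df≈b Fb Ff)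
                         (factorCount≤ O-hom O-nonUnit Of≈o Fo Ff)
      where
      -- The measure is the x-degree of `D p`; it decreases because `D` sends nonunit divisors of
      -- `f` to nonconstant polynomials.
      split : ∀ {n p x y} → p XY.∣ f × HasDegree (D p) n → XY.NonUnit x → XY.NonUnit y →
        p XY.≈ₚ x XY.*ₚ y →
        (∃ λ i → i < n × x XY.∣ f × HasDegree (D x) i) ×
        (∃ λ j → j < n × y XY.∣ f × HasDegree (D y) j)
      split {x = x} {y} (p∣f , Dp-n) x∤1 y∤1 p≈xy =
        let x∣f = XY.∣ʳ-trans (XY.∣-*ˡ p≈xy) p∣f
            y∣f = XY.∣ʳ-trans (XY.∣-*ʳ {x = x} p≈xy) p∣f
            (i , i<n , Dx-i) , (j , j<n , Dy-j) = X.splitDegree Dp-n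
              (D-nonUnit x∣f x∤1) (D-nonUnit y∣f y∤1)
              (X.≈ₚ-trans (D.⟦⟧-cong p≈xy) (D.homo x y))
        in (i , i<n , x∣f , Dx-i) , (j , j<n , y∣f , Dy-j)
      exists : ∃ λ k → XY.ProductOf XY.Irreducible k f
      exists = XY.factorize em (λ n p → p XY.∣ f × HasDegree (D p) n) split (XY.∣ʳ-refl , deg-D)

  -- The given polynomial and its nonunit divisors.

  deg<⇒Below : ∀ p q {d} → p X.deg< q → HasDegree q d → Below d p
  deg<⇒Below p q (d′ , q-d′ , p<d′) q-d with X.degree? _≟0ᴷ p
  ... | inj₁ p≈0       = λ i _ → X.coeff-≈ p≈0 i
  ... | inj₂ (e , p-e) = λ i d≤i → proj₂ p-e i
    (ℕₚ.<-≤-trans (≡.subst (e <_) (X.degree-unique q q-d′ q-d) (p<d′ e p-e)) d≤i)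

  coeff-tabulate : ∀ {n} (a : Fin n → X.Polynomial) i → coeff (tabulate a) (toℕ i) ≡ a i
  coeff-tabulate a zero    = ≡.refl
  coeff-tabulate a (suc i) = coeff-tabulate (a ∘ suc) i

  coeff-tabulate-≥ : ∀ {n} (a : Fin n → X.Polynomial) {i} → n ≤ i → coeff (tabulate a) i ≈ₚ []
  coeff-tabulate-≥ {zero}  a             n≤i       = X.≈ₚ-refl
  coeff-tabulate-≥ {suc n} a {i = suc i} (s≤s n≤i) = coeff-tabulate-≥ (a ∘ suc) n≤i

  Peak-tabulate : ∀ {n d} (a : Fin n → X.Polynomial) k → HasDegree (a k) d →
                  (∀ i → i ≢ k → a i X.deg< a k) → Peak (tabulate a) (toℕ k) d
  Peak-tabulate {n} {d} a k ak-d others =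
    peak (≡.subst (λ p → HasDegree p d) (≡.sym (coeff-tabulate a k)) ak-d) elsewhere
    where
    elsewhere : ∀ j → j ≢ toℕ k → Below d (coeff (tabulate a) j)
    elsewhere j j≢k with ℕₚ.<-≤-connex j n
    ... | inj₂ n≤j = λ i _ → X.coeff-≈ (coeff-tabulate-≥ a n≤j) i
    ... | inj₁ j<n = ≡.subst (Below d)
      (≡.trans (≡.sym (coeff-tabulate a (fromℕ< j<n))) (≡.cong (coeff (tabulate a)) (toℕ-fromℕ< j<n)))
      (deg<⇒Below (a (fromℕ< j<n)) (a k) (others (fromℕ< j<n) λ where ≡.refl → j≢k (≡.sym (toℕ-fromℕ< j<n))) ak-d)

  module Ends {n : ℕ} (a : Fin (suc n) → X.Polynomial)
    (a₀≉0 : ¬ a zero ≈ₚ []) (aₙ≉0 : ¬ a (fromℕ n) ≈ₚ [])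
    (noConstFactor : BivariatePolynomials.K[x,y].NoNonconstantFactorIn-K[x] K (tabulate a))
    where

    f : XY.Polynomial
    f = tabulate a

    coeff-n : coeff f n ≡ a (fromℕ n)
    coeff-n = ≡.trans (≡.cong (coeff f) (≡.sym (toℕ-fromℕ n))) (coeff-tabulate a (fromℕ n))

    f-n : XY.HasDegree f n
    f-n = ≡.subst (λ p → ¬ p ≈ₚ []) (≡.sym coeff-n) aₙ≉0 , λ i → coeff-tabulate-≥ a

    lc-f : lcʸ f ≈ₚ a (fromℕ n)
    lc-f = ≡.subst (lcʸ f ≈ₚ_) coeff-n (XY.lc-degree _≟0ˣ f f-n)

    record Split (g : XY.Polynomial) : Set (c ⊔ ℓ) where
      field
        cofactor : XY.Polynomial
        f≈gh     : f XY.≈ₚ g XY.*ₚ cofactor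
        m l      : ℕ
        g-m      : XY.HasDegree g m
        h-l      : XY.HasDegree cofactor l
        m+l≡n    : m ℕ.+ l ≡ n
        0<m      : 0 < m
        g₀≉0     : ¬ coeff g 0 ≈ₚ []

    factorSplit : ∀ {g} → g XY.∣ f → XY.NonUnit g → Split g
    factorSplit {g} (h , hg≈f) g∤1
      with f≈gh ← XY.trans (XY.sym hg≈f) (XY.*ₚ-comm h g)
      with XY.HasDegree-factors _≟0ˣ X.K[x]-noZeroDivisors g h f-n f≈gh
    ... | m , l , g-m , h-l , m+l≡n = record
      { cofactor = h ; f≈gh = f≈gh ; g-m = g-m ; h-l = h-l ; m+l≡n = m+l≡n
      ; 0<m = ℕₚ.n≢0⇒n>0 λ where ≡.refl → g∤1 (g∣1 g-m)
      ; g₀≉0 = λ g₀≈0 → a₀≉0 (X.≈ₚ-trans (XY.coeff-≈ f≈gh 0)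
          (X.≈ₚ-trans (XY.coeff-*-0 g h) (X.*ₚ-cong {q = coeff h 0} g₀≈0 X.≈ₚ-refl)))
      }
      where
      -- A divisor of degree 0 in y lies in K[x], so by the assumption on `f` it is a nonzero
      -- constant, hence a unit. Nonunit divisors therefore have positive degree in y.
      g∣1 : XY.HasDegree g 0 → g XY.∣ XY.const 1ˣ
      g∣1 g-0 with noConstFactor (coeff g 0) (h , XY.trans (XY.*ₚ-congˡ h (XY.sym (XY.HasDegree-0⇒const g-0))) hg≈f)
      ... | b , g₀≈b with X.degree _≟0ᴷ (proj₁ g-0)
      ...   | d , g₀-d with X.HasDegree-0⇒∣1 {coeff g 0}
                (≡.subst (HasDegree (coeff g 0)) (ℕₚ.n<1⇒n≡0
                  (X.degree<bound (coeff g 0) g₀-d (X.Below-resp (X.≈ₚ-sym g₀≈b) (X.Below-length (X.const b))))) g₀-d)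
      ...     | v , vg₀≈1 = XY.const v ,
                XY.trans (XY.*ₚ-congˡ (XY.const v) (XY.HasDegree-0⇒const g-0))
                  (XY.∷-cong (X.≈ₚ-trans (X.+ₚ-identityʳ _) vg₀≈1) XY.refl)

    splitPeak : ∀ {k d g} → Peak f k d → (S : Split g) → (let open Split S) →
                ∃₂ λ i j → i ℕ.+ j ≡ k × ∃ (Peak g i) × ¬ coeff cofactor j ≈ₚ []
    splitPeak {g = g} f-peak S = Peak-factor f-peak f≈gh
      (XY.HasDegree⇒≉0 g g-m) (XY.HasDegree⇒≉0 cofactor h-l)
      where open Split S

    -- `i + j = 0` puts the peak of `g` at index 0; as `g` has positive degree in y, its leading
    -- coefficient sits at another index and stays strictly below the peak.
    drop₀ : ∀ {d} → Peak f 0 d → ∀ {g} → g XY.∣ f → XY.NonUnit g →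
            ∃₂ λ d e → HasDegree (coeff g 0) d × HasDegree (lcʸ g) e × e < d
    drop₀ f-peak {g} g∣f g∤1 = drop (factorSplit g∣f g∤1)
      where
      drop : Split g → ∃₂ λ d e → HasDegree (coeff g 0) d × HasDegree (lcʸ g) e × e < d
      drop S =
        let open Split S
            i , j , i+j≡0 , (d , g-peak) , _ = splitPeak f-peak S
            peak g₀-d g<d = ≡.subst (λ i → Peak g i d) (ℕₚ.m+n≡0⇒m≡0 i i+j≡0) g-peak
            e , gm-e = X.degree _≟0ᴷ (proj₁ g-m)
        in d , e , g₀-d , X.HasDegree-resp (X.≈ₚ-sym (XY.lc-degree _≟0ˣ g g-m)) gm-e ,
           X.degree<bound (coeff g m) gm-e (g<d m (ℕₚ.n>0⇒n≢0 0<m))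

    dropₙ : ∀ {d} → Peak f n d → ∀ {g} → g XY.∣ f → XY.NonUnit g →
            ∃₂ λ d e → HasDegree (lcʸ g) d × HasDegree (coeff g 0) e × e < d
    dropₙ f-peak {g} g∣f g∤1 = drop (factorSplit g∣f g∤1)
      where
      drop : Split g → ∃₂ λ d e → HasDegree (lcʸ g) d × HasDegree (coeff g 0) e × e < d
      drop S =
        let i , j , i+j≡n , (d , g-peak) , hj≉0 = splitPeak f-peak S
            -- `i + j = n = m + l` with `i ≤ m` and `j ≤ l` forces `i = m`: the peak of `g` is at
            -- its leading coefficient.
            i≡m = ℕₚ.≤-antisym (XY.≤-degree g g-m (X.HasDegree⇒≉0 (coeff g i) (Peak.at g-peak)))
              (ℕₚ.+-cancelʳ-≤ l m i (ℕₚ.≤-trans (ℕₚ.≤-reflexive (≡.trans m+l≡n (≡.sym i+j≡n)))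
                (ℕₚ.+-monoʳ-≤ i (XY.≤-degree cofactor h-l hj≉0))))
            peak gm-d g<d = ≡.subst (λ i → Peak g i d) i≡m g-peak
            e , g₀-e = X.degree _≟0ᴷ g₀≉0
        in d , e , X.HasDegree-resp (X.≈ₚ-sym (XY.lc-degree _≟0ˣ g g-m)) gm-d , g₀-e ,
           X.degree<bound (coeff g 0) g₀-e (g<d 0 (ℕₚ.<⇒≢ 0<m))
        where open Split S

-- Assembly of the two cases.

theorem2 : ∀ {c ℓ} → ExcludedMiddle (c ⊔ ℓ) → (K : Field c ℓ) →
    let open BivariatePolynomials K in
    let open K[x] in
    (n : ℕ) → 2 ≤ n →
    (a : Fin (suc n) → K[x].Carrier) →
    let a₀ = a zero
        aₙ = a (fromℕ n)
        f  = tabulate a in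
    ¬ (a₀ * aₙ ≈ 0#) →
    K[x,y].NoNonconstantFactorIn-K[x] f →
    (ν₀ νₙ : ℕ) → IrreducibleFactorization a₀ ν₀ → IrreducibleFactorization aₙ νₙ →
    ( ( Reducible a₀
      × (∃ λ q → SmallestIrreducibleFactor q a₀ × DegreeGap aₙ a₀ q)
      × (∀ i → i ≢ zero → a i deg< a₀) )
    ⊎ ( Reducible aₙ
      × (∃ λ q → SmallestIrreducibleFactor q aₙ × DegreeGap a₀ aₙ q)
      × (∀ i → i ≢ fromℕ n → a i deg< aₙ) ) ) →
    K[x,y].ProductOfAtMost (ν₀ ⊓ νₙ) f
theorem2 em K n _ a a₀aₙ≉0 noConstFactor ν₀ νₙ F₀ Fₙ = λ where
    (inj₁ (reducible , (q , (q-irr , _ , q-min) , dₙ , d₀ , d_q , aₙ-d , a₀-d , q-d , gap) , others)) →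
      Counting.productOfAtMost coeff-0-homomorphism lc-homomorphism
        (drop₀ (Peak-tabulate a zero a₀-d others))
        reducible q-irr q-min a₀-d (X.HasDegree-resp (X.≈ₚ-sym lc-f) aₙ-d) q-d gap
        X.≈ₚ-refl lc-f F₀ Fₙ
    (inj₂ (reducible , (q , (q-irr , _ , q-min) , d₀ , dₙ , d_q , a₀-d , aₙ-d , q-d , gap) , others)) →
      -- Here the leading coefficient dominates, so the count yields the minimum with its arguments
      -- exchanged.
      ≡.subst (λ ν → XY.ProductOfAtMost ν f) (ℕₚ.⊓-comm νₙ ν₀)
        (Counting.productOfAtMost lc-homomorphism coeff-0-homomorphism
          (dropₙ (≡.subst (λ k → Peak f k dₙ) (toℕ-fromℕ n) (Peak-tabulate a (fromℕ n) aₙ-d others)))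
          (reducible-resp reducible) q-irr
          (λ r r-irr r∣ → q-min r r-irr (X.∣ʳ-respʳ-≈ lc-f r∣))
          (X.HasDegree-resp (X.≈ₚ-sym lc-f) aₙ-d) a₀-d q-d gap
          lc-f X.≈ₚ-refl Fₙ F₀)
  where
  open Bivariate em K
  open Ends a
    (λ a₀≈0 → a₀aₙ≉0 (X.*ₚ-cong {q = a (fromℕ n)} a₀≈0 X.≈ₚ-refl))
    (λ aₙ≈0 → a₀aₙ≉0 (X.≈ₚ-trans (X.*ₚ-congˡ (a zero) aₙ≈0) (X.*ₚ-zeroʳ (a zero))))
    noConstFactor
  reducible-resp : X.Reducible (a (fromℕ n)) → X.Reducible (lcʸ f)
  reducible-resp (x , y , x∤1 , y∤1 , aₙ≈xy) = x , y , x∤1 , y∤1 , X.≈ₚ-trans lc-f aₙ≈xy
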